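{- Let $G$ be a connected hypergraph. Then $\chi_{\mathrm{DP}}(G)\le\Delta(G)+1$, and equality holds if and only if $G$ is a DP-hyperbrick, i.e. $G=tK_n$ for some $t,n\ge1$, or $G=tC_n$ for some $t\ge1$, $n\ge3$, or $G$ consists of a single edge $e$ with $V(G)=i_G(e)$.
   Context: A hypergraph $G=(V,E,i)$ has finite vertex and edge sets and $i:E\to2^V$ with $|i(e)|\ge2$; parallel edges allowed. $d_G(v)$ is the number of edges containing $v$ and $\Delta(G)$ the maximum degree. $G[Y]$ is the induced subhypergraph on $Y$ (edges $e$ with $i(e)\subseteq Y$); $Y$ independent if $G[Y]$ has no edges. $G$ is connected if any two vertices are joined by a sequence of distinct vertices $v_1,\dots,v_{q+1}$ and distinct edges $e_1,\dots,e_q$ with $\{v_j,v_{j+1}\}\subseteq i(e_j)$. $tK_n$ and $tC_n$ denote the complete graph and cycle on $n$ vertices with each edge replaced by $t$ parallel ordinary (2-vertex) edges. Cover $(X,H)$ of $G$: pairwise disjoint sets $X_v$ ($v\in V(G)$); $H$ a hypergraph with $V(H)=\bigcup X_v$, each $X_v$ independent in $H$, and for each $e\in E(G)$ a possibly empty matching $M_e$ (pairwise vertex-disjoint edges) in $H[\bigcup_{v\in i(e)}X_v]$ whose edges meet each $X_v$, $v\in i(e)$, in exactly one vertex, with $E(H)=\bigcup M_e$. $G$ is $(X,H)$-colorable if there is an independent set $T$ of $H$ with $|T\cap X_v|=1$ for all $v$. The DP-chromatic number $\chi_{\mathrm{DP}}(G)$ is the least $k\ge0$ such that $G$ is $(X,H)$-colorable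 for every cover $(X,H)$ with $|X_v|\ge k$ for all $v$. -}

module Defs where

open import Data.Nat using (ℕ; zero; suc; _+_; _≤_; _<_; _⊔_)
open import Data.Fin using (Fin; toℕ; _≟_) renaming (zero to fzero; suc to fsuc)
open import Data.Bool using (Bool; true; false; if_then_else_; _∧_)
open import Data.Product using (Σ; ∃; _×_; _,_)
open import Data.Sum using (_⊎_)
open import Function.Definitions using (Injective)
open import Relation.Nullary using (¬_)
open import Relation.Nullary.Decidable using (⌊_⌋)
open import Relation.Binary.PropositionalEquality using (_≡_; _≢_)

count : ∀ {m} → (Fin m → Bool) → ℕ
count {zero}  f = 0
count {suc m} f = (if f fzero then 1 else 0) + count (λ x → f (fsuc x))

maxOver : ∀ {n} → (Fin n → ℕ) → ℕ
maxOver {zero}  f = 0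
maxOver {suc n} f = f fzero ⊔ maxOver (λ x → f (fsuc x))

_==ᶠ_ : ∀ {n} → Fin n → Fin n → Bool
a ==ᶠ b = ⌊ a ≟ b ⌋

-- Hypergraph with V = Fin nV, E = Fin nE, i(e) = {v | inc e v ≡ true}.
-- Parallel edges are allowed (distinct e with the same inc e).
record Hypergraph : Set where
  field
    nV   : ℕ
    nE   : ℕ
    inc  : Fin nE → Fin nV → Bool
    size : ∀ e → 2 ≤ count (inc e)
open Hypergraph public

degree : (G : Hypergraph) → Fin (nV G) → ℕ
degree G v = count (λ e → inc G e v)

Δ : Hypergraph → ℕ
Δ G = maxOver (degree G)

Connected : Hypergraph → Set
Connected G = ∀ (u w : Fin (nV G)) →
  Σ ℕ λ q → Σ (Fin (suc q) → Fin (nV G)) λ vs → Σ (Fin q → Fin (nE G)) λ es →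
    Injective _≡_ _≡_ vs × Injective _≡_ _≡_ es ×
    vs fzero ≡ u × vs (Data.Fin.fromℕ q) ≡ w ×
    (∀ j → inc G (es j) (vs (Data.Fin.inject₁ j)) ≡ true × inc G (es j) (vs (fsuc j)) ≡ true)

-- A cover (X,H) of G.  V(H) = Fin N; X_v = {x | p x ≡ v} (so the X_v are
-- pairwise disjoint and cover V(H)).  For each e, M_e consists of the edges
-- M e j (j : Fin (r e)), each given by its vertex set; E(H) is the disjoint
-- union of the M_e.
record Cover (G : Hypergraph) : Set where
  field
    N   : ℕ
    p   : Fin N → Fin (nV G)
    r   : Fin (nE G) → ℕ
    M   : (e : Fin (nE G)) → Fin (r e) → Fin N → Bool
    M-sub      : ∀ e j x → M e j x ≡ true → inc G e (p x) ≡ true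
    M-meets    : ∀ e j v → inc G e v ≡ true →
                 count (λ x → M e j x ∧ (p x ==ᶠ v)) ≡ 1
    M-matching : ∀ e j j' x → M e j x ≡ true → M e j' x ≡ true → j ≡ j'
open Cover public

fiberSize : ∀ {G} → Cover G → Fin (nV G) → ℕ
fiberSize C v = count (λ x → p C x ==ᶠ v)

Colorable : ∀ {G} → Cover G → Set
Colorable {G} C = Σ (Fin (N C) → Bool) λ T →
  (∀ v → count (λ x → T x ∧ (p C x ==ᶠ v)) ≡ 1) ×
  (∀ e j → ¬ (∀ x → M C e j x ≡ true → T x ≡ true))

DPColorable : Hypergraph → ℕ → Set
DPColorable G k = ∀ (C : Cover G) → (∀ v → k ≤ fiberSize C v) → Colorable C

IsDPChromaticNumber : Hypergraph → ℕ → Set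
IsDPChromaticNumber G k = DPColorable G k × (∀ j → j < k → ¬ DPColorable G j)

mult : (G : Hypergraph) → Fin (nV G) → Fin (nV G) → ℕ
mult G u v = count (λ e → inc G e u ∧ inc G e v)

Ordinary : Hypergraph → Set
Ordinary G = ∀ e → count (inc G e) ≡ 2

IsTK : Hypergraph → Set
IsTK G = Σ ℕ λ t → 1 ≤ t × 1 ≤ nV G × Ordinary G ×
  (∀ u v → u ≢ v → mult G u v ≡ t)

CycAdj : ∀ {n} → Fin n → Fin n → Set
CycAdj {n} a b = suc (toℕ a) ≡ toℕ b ⊎ suc (toℕ b) ≡ toℕ a ⊎
  (toℕ a ≡ 0 × suc (toℕ b) ≡ n) ⊎ (toℕ b ≡ 0 × suc (toℕ a) ≡ n)

-- G = tC_n (up to isomorphism) for some t ≥ 1, n ≥ 3: a bijection σ from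
-- Fin n (cyclically ordered) onto V(G) such that consecutive vertices are
-- joined by exactly t edges and nonconsecutive ones by none
-- (an injective map Fin n → Fin n is a bijection)
IsTC : Hypergraph → Set
IsTC G = Σ ℕ λ t → 1 ≤ t × 3 ≤ nV G × Ordinary G ×
  Σ (Fin (nV G) → Fin (nV G)) λ σ →
    Injective _≡_ _≡_ σ ×
    (∀ a b → a ≢ b → (CycAdj a b → mult G (σ a) (σ b) ≡ t) ×
                      (¬ CycAdj a b → mult G (σ a) (σ b) ≡ 0))

IsSingleEdge : Hypergraph → Set
IsSingleEdge G = Σ (nE G ≡ 1) λ _ → ∀ e v → inc G e v ≡ true

DPHyperbrick : Hypergraph → Set
DPHyperbrick G = IsTK G ⊎ IsTC G ⊎ IsSingleEdge G

{-# OPTIONS --safe #-}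
module Submission where

-- Suppose G is connected and some cover with Δ(G) colours per vertex admits no colouring. Colouring greedily
-- towards a root a leaves only a uncoloured; then every edge at a must forbid exactly one colour at a, and
-- distinct edges distinct colours. Hence G is regular, and any precolouring of a set S with V ∖ S connected
-- to a that breaks this tightness is a contradiction. Choosing S suitably (as in Zając's proof of Brooks'
-- theorem) shows in turn: a longest path closes up to a Hamilton cycle; an edge with at least 3 vertices is
-- the only edge; for an ordinary G, a neighbour d of a and any further vertex b such that a is reachable from
-- all of V ∖ {b, d}, mult a b ≤ mult b d; and 2 · mult v w ≤ Δ(G) unless v, w are joined by all edges at v.
-- The third fact makes a Hamilton cycle with a chord complete with constant multiplicity, and the fourth
-- makes a chordless one a t-fold cycle. Conversely, each brick has an uncolorable cover with Δ(G) colours, in which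
-- parallel edges form complete bipartite graphs between groups of t colours.

open import Defs
open import Data.Nat using (ℕ; zero; suc; _+_; _*_; _∸_; _≤_; _<_; z≤n; s≤s; s≤s⁻¹; _≤?_; NonZero)
open import Data.Nat.DivMod using (_%_; %-distribˡ-+; m%n%n≡m%n; [m+n]%n≡m%n; m<n⇒m%n≡m; m%n<n)
open import Data.Nat.Properties as ℕₚ using (≤-refl; ≤-trans; ≤-reflexive; ≤-antisym; anyUpTo?)
open import Data.Fin using (Fin; toℕ; _≟_; inject₁; fromℕ; fromℕ<; combine; remQuot) renaming (zero to fzero; suc to fsuc)
open import Data.Fin.Properties using (any?; all?; suc-injective; toℕ-injective; toℕ<n; toℕ-fromℕ<; injective⇒≤; ¬∀⟶∃¬; pigeonhole; remQuot-combine; combine-remQuot; combine-injective)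
open import Data.Fin.Subset.Properties using (anySubset?)
open import Data.Vec using (lookup; tabulate)
open import Data.Vec.Properties using (lookup∘tabulate)
open import Data.Bool using (Bool; true; false; _∧_; _∨_; not; if_then_else_) renaming (_≟_ to _≟ᵇ_)
open import Data.Bool.Properties using (∧-identityʳ; ∧-comm; ∨-zeroʳ)
open import Data.Product using (Σ; ∃; _×_; _,_; proj₁; proj₂)
open import Data.Sum using (_⊎_; inj₁; inj₂)
open import Data.Empty using (⊥; ⊥-elim)
open import Function.Bundles using (_⇔_; mk⇔)
open import Function.Definitions using (Injective)
open import Relation.Nullary using (¬_; Dec; yes; no; contradiction; does)
open import Relation.Nullary.Decidable using (¬?; _×-dec_; _⊎-dec_; _→-dec_; decidable-stable; map′; dec-true; dec-false)
open import Relation.Unary using (Decidable)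
open import Relation.Binary.Definitions using (tri<; tri≈; tri>)
open import Relation.Binary.Construct.Closure.ReflexiveTransitive as Star using (Star; ε; _◅_; _◅◅_)
open import Relation.Binary.PropositionalEquality

-- A cover gives colours no names shared by different vertices, so the usual step of giving two
-- neighbours of `a` the same colour has no meaning. Its substitute is to precolour two vertices so
-- that the matchings of two edges at `a` single out the same colour there. Tightness itself
-- supplies such colours: precolouring one vertex `u` shows that an edge matches every colour at `u`
-- to some colour at its other vertices, and that distinct edges on the same two vertices do so
-- disjointly. The comparisons of multiplicities are then injections from edges to edges that pass
-- through colours. They are stated as inequalities because adjacency alone would not show that a
-- brick has constant multiplicity.

private variable
  m n : ℕ

-- Counting

∧-split : ∀ {a b} → a ∧ b ≡ true → a ≡ true × b ≡ true
∧-split {true} {true} _ = refl , refl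

∧-join : ∀ {a b} → a ≡ true → b ≡ true → a ∧ b ≡ true
∧-join refl refl = refl

not-false : ∀ {a} → a ≢ true → a ≡ false
not-false {true} p = contradiction refl p
not-false {false} _ = refl

not-true : ∀ {a} → not a ≡ true → a ≡ false
not-true {false} _ = refl

true≢false : ∀ {a} → a ≡ true → a ≡ false → ⊥
true≢false refl ()

==ᶠ⇒≡ : {a b : Fin n} → (a ==ᶠ b) ≡ true → a ≡ b
==ᶠ⇒≡ {a = a} {b} p with a ≟ b
... | yes q = q

==ᶠ⇐≡ : {a b : Fin n} → a ≡ b → (a ==ᶠ b) ≡ true
==ᶠ⇐≡ {a = a} {b} q with a ≟ b
... | yes _ = refl
... | no p = contradiction q p

==ᶠ⇐≢ : {a b : Fin n} → a ≢ b → (a ==ᶠ b) ≡ false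
==ᶠ⇐≢ {a = a} {b} q with a ≟ b
... | yes p = contradiction p q
... | no _ = refl

==ᶠ⇒≢ : {a b : Fin n} → (a ==ᶠ b) ≡ false → a ≢ b
==ᶠ⇒≢ p q = true≢false (==ᶠ⇐≡ q) p

infixl 6 _∖_

_∖_ : (Fin n → Bool) → Fin n → Fin n → Bool
(P ∖ y) z = P z ∧ not (z ==ᶠ y)

∖⁺ : (P : Fin n → Bool) {y z : Fin n} → P z ≡ true → z ≢ y → (P ∖ y) z ≡ true
∖⁺ P p q = ∧-join p (cong not (==ᶠ⇐≢ q))

∖⁻ : (P : Fin n → Bool) {y z : Fin n} → (P ∖ y) z ≡ true → P z ≡ true × z ≢ y
∖⁻ P {y} {z} p with ∧-split {P z} p
... | a , b = a , ==ᶠ⇒≢ (not-true b)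

count-cong : {P Q : Fin n → Bool} → (∀ x → P x ≡ Q x) → count P ≡ count Q
count-cong {zero} h = refl
count-cong {suc n} h =
  cong₂ _+_ (cong (if_then 1 else 0) (h fzero)) (count-cong (λ x → h (fsuc x)))

∖-fsuc : (P : Fin (suc n) → Bool) (y x : Fin n) → (P ∖ fsuc y) (fsuc x) ≡ ((λ z → P (fsuc z)) ∖ y) x
∖-fsuc P y x with x ≟ y
... | yes _ = refl
... | no _ = refl

count-∖ : (P : Fin n → Bool) (y : Fin n) → P y ≡ true → suc (count (P ∖ y)) ≡ count P
count-∖ {suc n} P fzero h rewrite h =
  cong suc (count-cong λ x → ∧-identityʳ (P (fsuc x)))
count-∖ {suc n} P (fsuc y) h with P fzero | count-∖ (λ x → P (fsuc x)) y h
... | true | ih = cong suc (trans (cong suc (count-cong (∖-fsuc P y))) ih)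
... | false | ih = trans (cong suc (count-cong (∖-fsuc P y))) ih

-- Injectivity is asked of the relation `B`, not of a function: callers find a witness by search or
-- case split and then only show that one `y` cannot serve two `x`. Removing the first witness from
-- `Q` keeps the induction going.
count-inj : (P : Fin m → Bool) (Q : Fin n → Bool) (B : Fin m → Fin n → Set) →
  (∀ x → P x ≡ true → Σ (Fin n) λ y → Q y ≡ true × B x y) →
  (∀ x x' y → P x ≡ true → P x' ≡ true → B x y → B x' y → x ≡ x') →
  count P ≤ count Q
count-inj {zero} P Q B f inj = z≤n
count-inj {suc m} P Q B f inj with P fzero in P0
... | false = count-inj (λ x → P (fsuc x)) Q (λ x → B (fsuc x)) (λ x → f (fsuc x))
                (λ x x' y p p' b b' → suc-injective (inj _ _ y p p' b b'))
... | true with f fzero P0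
...   | y₀ , Qy₀ , B₀ = subst (suc (count (λ x → P (fsuc x))) ≤_) (count-∖ Q y₀ Qy₀)
    (s≤s (count-inj (λ x → P (fsuc x)) (Q ∖ y₀) (λ x → B (fsuc x)) g
           (λ x x' y p p' b b' → suc-injective (inj _ _ y p p' b b'))))
  where
  g : ∀ x → P (fsuc x) ≡ true → Σ _ λ y → (Q ∖ y₀) y ≡ true × B (fsuc x) y
  g x Px with f (fsuc x) Px
  ... | y , Qy , Bxy = y , ∖⁺ Q Qy (λ { refl → case0 (inj fzero (fsuc x) y P0 Px B₀ Bxy) }) , Bxy
    where
    case0 : fzero ≡ fsuc x → ⊥
    case0 ()

count-mono : (P Q : Fin n → Bool) → (∀ x → P x ≡ true → Q x ≡ true) → count P ≤ count Q
count-mono P Q h = count-inj P Q _≡_ (λ x p → x , h x p , refl) (λ { _ _ _ _ _ refl refl → refl })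

count-mono-< : (P Q : Fin n → Bool) (y : Fin n) → Q y ≡ true → P y ≡ false →
  (∀ x → P x ≡ true → Q x ≡ true) → count P < count Q
count-mono-< P Q y Qy Py h = subst (suc (count P) ≤_) (count-∖ Q y Qy)
  (s≤s (count-mono P (Q ∖ y) λ x Px → ∖⁺ Q (h x Px) λ { refl → true≢false Px Py }))

count-split : (P Q : Fin n → Bool) → count P ≡ count (λ x → P x ∧ Q x) + count (λ x → P x ∧ not (Q x))
count-split {zero} P Q = refl
count-split {suc n} P Q with P fzero | Q fzero | count-split (λ x → P (fsuc x)) (λ x → Q (fsuc x))
... | true | true | ih = cong suc ih
... | true | false | ih = trans (cong suc ih) (sym (ℕₚ.+-suc _ _))
... | false | _ | ih = ih

count-pos : (P : Fin n → Bool) → 0 < count P → ∃ λ x → P x ≡ true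
count-pos {suc n} P h with P fzero in P0
... | true = fzero , P0
... | false with count-pos (λ x → P (fsuc x)) h
...   | x , Px = fsuc x , Px

count-zero : (P : Fin n → Bool) → (∀ x → P x ≡ false) → count P ≡ 0
count-zero {zero} P h = refl
count-zero {suc n} P h rewrite h fzero = count-zero (λ x → P (fsuc x)) (λ x → h (fsuc x))

count>0 : (P : Fin n → Bool) {x : Fin n} → P x ≡ true → 0 < count P
count>0 P {x} Px = subst (0 <_) (count-∖ P x Px) (s≤s z≤n)

count-another : (P : Fin n → Bool) (y : Fin n) → 2 ≤ count P → ∃ λ x → P x ≡ true × x ≢ y
count-another P y h with P y in Py
... | true with count-pos (P ∖ y) (s≤s⁻¹ (subst (2 ≤_) (sym (count-∖ P y Py)) h))
...   | x , q = x , ∖⁻ P q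
count-another P y h | false with count-pos P (≤-trans (s≤s z≤n) h)
...   | x , Px = x , Px , λ { refl → true≢false Px Py }

count-third : (P : Fin n → Bool) (y z : Fin n) → 3 ≤ count P → ∃ λ x → P x ≡ true × x ≢ y × x ≢ z
count-third P y z h with P y in Py
... | true with count-another (P ∖ y) z (s≤s⁻¹ (subst (3 ≤_) (sym (count-∖ P y Py)) h))
...   | x , q , x≢z = x , proj₁ (∖⁻ P q) , proj₂ (∖⁻ P q) , x≢z
count-third P y z h | false with count-another P z (≤-trans (s≤s (s≤s z≤n)) h)
...   | x , Px , x≢z = x , Px , (λ { refl → true≢false Px Py }) , x≢z

count-≡1 : (P : Fin n → Bool) (y : Fin n) → P y ≡ true → (∀ x → P x ≡ true → x ≡ y) → count P ≡ 1
count-≡1 P y Py h = trans (sym (count-∖ P y Py))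
  (cong suc (count-zero (P ∖ y) λ x → not-false λ q → proj₂ (∖⁻ P q) (h x (proj₁ (∖⁻ P q)))))

count-1-unique : (P : Fin n → Bool) → count P ≡ 1 → ∀ {x y} → P x ≡ true → P y ≡ true → x ≡ y
count-1-unique P h {x} {y} Px Py with x ≟ y
... | yes q = q
... | no q = contradiction (trans (cong suc (count-∖ (P ∖ y) x (∖⁺ P Px q))) (trans (count-∖ P y Py) h)) λ ()

count-2-exhaust : (P : Fin n → Bool) → count P ≡ 2 → ∀ {x y z} → P x ≡ true → P y ≡ true → x ≢ y →
  P z ≡ true → z ≡ x ⊎ z ≡ y
count-2-exhaust P h {x} {y} {z} Px Py x≢y Pz with z ≟ x
... | yes q = inj₁ q
... | no q = inj₂ (count-1-unique (P ∖ x) (ℕₚ.suc-injective (trans (count-∖ P x Px) h)) (∖⁺ P Pz q) (∖⁺ P Py (λ r → x≢y (sym r))))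

count-all : ∀ n → count {n} (λ _ → true) ≡ n
count-all zero = refl
count-all (suc n) = cong suc (count-all n)

maxOver-upper : (f : Fin n → ℕ) (x : Fin n) → f x ≤ maxOver f
maxOver-upper f fzero = ℕₚ.m≤m⊔n _ _
maxOver-upper f (fsuc x) = ≤-trans (maxOver-upper (λ y → f (fsuc y)) x) (ℕₚ.m≤n⊔m _ _)

maxOver-least : (f : Fin n → ℕ) (k : ℕ) → (∀ x → f x ≤ k) → maxOver f ≤ k
maxOver-least {zero} f k h = z≤n
maxOver-least {suc n} f k h = ℕₚ.⊔-lub (h fzero) (maxOver-least _ k (λ x → h (fsuc x)))

∨-split : ∀ {a b} → a ∨ b ≡ true → a ≡ true ⊎ b ≡ true
∨-split {true} _ = inj₁ refl
∨-split {false} p = inj₂ p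

∨-false : ∀ {a b} → a ∨ b ≡ false → a ≡ false × b ≡ false
∨-false {false} p = refl , p

-- Greedy colouring of covers

upd : {A : Set} → (Fin n → A) → Fin n → A → Fin n → A
upd f v x u = if u ==ᶠ v then x else f u

upd-same : {A : Set} (f : Fin n → A) {v : Fin n} {x : A} → upd f v x v ≡ x
upd-same f {v} rewrite ==ᶠ⇐≡ {a = v} {v} refl = refl

upd-other : {A : Set} (f : Fin n → A) {v u : Fin n} {x : A} → u ≢ v → upd f v x u ≡ f u
upd-other f q rewrite ==ᶠ⇐≢ q = refl

module _ (G : Hypergraph) where

  Adj : Fin (nV G) → Fin (nV G) → Set
  Adj u v = ∃ λ e → inc G e u ≡ true × inc G e v ≡ true

  Adj? : ∀ u v → Dec (Adj u v)
  Adj? u v = any? λ e → (inc G e u ≟ᵇ true) ×-dec (inc G e v ≟ᵇ true)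

  Adj-sym : ∀ {u v} → Adj u v → Adj v u
  Adj-sym (e , p , q) = e , q , p

  -- Only the two ends of a step must avoid `S`; the edge carrying it may meet `S`. Greedy colouring
  -- needs no more, since one uncoloured vertex keeps an edge harmless.
  AdjAv : (Fin (nV G) → Bool) → Fin (nV G) → Fin (nV G) → Set
  AdjAv S u v = S u ≡ false × S v ≡ false × Adj u v

  ConnAv : (Fin (nV G) → Bool) → Fin (nV G) → Set
  ConnAv S a = ∀ y → S y ≡ false → Star (AdjAv S) y a

  other : ∀ e v → ∃ λ u → inc G e u ≡ true × u ≢ v
  other e v = count-another (inc G e) v (size G e)

  crossing : ∀ {S} (R : Fin (nV G) → Bool) {y a} → Star (AdjAv S) y a → R y ≡ false → R a ≡ true →
    ∃ λ u → ∃ λ r → S u ≡ false × R u ≡ false × R r ≡ true × Adj u r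
  crossing R ε p q = contradiction (trans (sym q) p) λ ()
  crossing R (_◅_ {y} {z} (Sy , Sz , yz) w) p q with R z in Rz
  ... | true = y , z , Sy , p , Rz , yz
  ... | false = crossing R w Rz q

∅ : Fin n → Bool
∅ _ = false

⁅_⁆ : Fin n → Fin n → Bool
⁅ v ⁆ u = u ==ᶠ v

module _ {G : Hypergraph} (C : Cover G) where

  Selection : Set
  Selection = Fin (nV G) → Fin (N C)

  IsSection : Selection → Set
  IsSection φ = ∀ v → p C (φ v) ≡ v

  Hit : Fin (nE G) → Selection → Set
  Hit e φ = ∃ λ j → ∀ u → inc G e u ≡ true → M C e j (φ u) ≡ true

  hit? : ∀ e φ → Dec (Hit e φ)
  hit? e φ = any? λ j → all? λ u → (inc G e u ≟ᵇ true) →-dec (M C e j (φ u) ≟ᵇ true)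

  hit-cong : ∀ {e φ ψ} → (∀ u → inc G e u ≡ true → φ u ≡ ψ u) → Hit e φ → Hit e ψ
  hit-cong {e} h (j , k) = j , λ u p → subst (λ x → M C e j x ≡ true) (h u p) (k u p)

  hit-upd⁻ : ∀ {e φ v x} → inc G e v ≢ true → Hit e (upd φ v x) → Hit e φ
  hit-upd⁻ {φ = φ} v∉e = hit-cong λ u u∈e → upd-other φ λ { refl → v∉e u∈e }

  section-upd : ∀ {φ v x} → IsSection φ → p C x ≡ v → IsSection (upd φ v x)
  section-upd {φ} {v} {x} s px u with u ≟ v
  ... | yes refl = px
  ... | no _ = s u

  Linked : Fin (nE G) → Fin (N C) → Fin (N C) → Set
  Linked e x y = ∃ λ j → M C e j x ≡ true × M C e j y ≡ true

  linked? : ∀ e x y → Dec (Linked e x y)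
  linked? e x y = any? λ j → (M C e j x ≟ᵇ true) ×-dec (M C e j y ≟ᵇ true)

  linked-sym : ∀ {e x y} → Linked e x y → Linked e y x
  linked-sym (j , a , b) = j , b , a

  linked-unique : ∀ {e x y z} → Linked e x y → Linked e x z → p C y ≡ p C z → y ≡ z
  linked-unique {e} {x} {y} {z} (j , jx , jy) (k , kx , kz) pq with M-matching C e j k x jx kx
  ... | refl = count-1-unique _ (M-meets C e j (p C z) (M-sub C e j z kz))
                 (∧-join jy (==ᶠ⇐≡ pq)) (∧-join kz (==ᶠ⇐≡ refl))

  hit-linked : ∀ {e φ u w} → Hit e φ → inc G e u ≡ true → inc G e w ≡ true → Linked e (φ u) (φ w)
  hit-linked (j , h) p q = j , h _ p , h _ q

  hit-linked-upd : ∀ {e φ v x u} → Hit e (upd φ v x) → inc G e v ≡ true → inc G e u ≡ true → u ≢ v →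
    Linked e (φ u) x
  hit-linked-upd {e} {φ} {v} {x} {u} h p q u≢v =
    subst₂ (Linked e) (upd-other φ u≢v) (upd-same φ) (hit-linked h q p)

  -- An edge at `v` has a further vertex `u`, whose colour already singles out the matching edge. So
  -- an edge forbids at most one colour at `v`; all counting of colours against edges rests on this.
  hit-unique : ∀ {e φ v x y} → inc G e v ≡ true → p C x ≡ v → p C y ≡ v →
    Hit e (upd φ v x) → Hit e (upd φ v y) → x ≡ y
  hit-unique {e} {φ} {v} v∈e px py hx hy with other G e v
  ... | u , u∈e , u≢v = linked-unique (hit-linked-upd hx v∈e u∈e u≢v) (hit-linked-upd hy v∈e u∈e u≢v) (trans px (sym py))

  blocked-count : ∀ φ v (F : Fin (nE G) → Bool) →
    (∀ x → p C x ≡ v → ∃ λ e → F e ≡ true × inc G e v ≡ true × Hit e (upd φ v x)) → fiberSize C v ≤ count F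
  blocked-count φ v F h = count-inj _ F (λ x e → inc G e v ≡ true × Hit e (upd φ v x))
    (λ x q → h x (==ᶠ⇒≡ q))
    (λ { x y e px py (v∈e , hx) (_ , hy) → hit-unique v∈e (==ᶠ⇒≡ px) (==ᶠ⇒≡ py) hx hy })

  blocked? : ∀ φ v (F : Fin (nE G) → Bool) x → Dec (∃ λ e → F e ≡ true × inc G e v ≡ true × Hit e (upd φ v x))
  blocked? φ v F x = any? λ e → (F e ≟ᵇ true) ×-dec ((inc G e v ≟ᵇ true) ×-dec hit? e (upd φ v x))

  choose : ∀ φ v (F : Fin (nE G) → Bool) → count F < fiberSize C v →
    ∃ λ x → p C x ≡ v × (∀ e → F e ≡ true → inc G e v ≡ true → ¬ Hit e (upd φ v x))
  choose φ v F lt with any? (λ x → (p C x ≟ v) ×-dec ¬? (blocked? φ v F x))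
  ... | yes (x , px , nb) = x , px , λ e Fe ve h → nb (e , Fe , ve , h)
  ... | no none = contradiction lt (ℕₚ.≤⇒≯ (blocked-count φ v F λ x px →
          decidable-stable (blocked? φ v F x) λ nb → none (x , px , nb)))

  -- `S` is the coloured set. Sections are total, so the values off `S` are placeholders, and a hit
  -- is a conflict only on an edge inside `S`.
  Proper : (Fin (nV G) → Bool) → Selection → Set
  Proper S φ = ∀ e → Hit e φ → ∃ λ v → inc G e v ≡ true × S v ≡ false

  AlmostProper : Fin (nV G) → Selection → Set
  AlmostProper a φ = ∀ e → Hit e φ → inc G e a ≡ true

  module _ (deg≤ : ∀ v → degree G v ≤ fiberSize C v) where

    private
      -- `R` is the uncoloured set. Quantifying over all colourings of its complement lets `R` grow
      -- from the root: the vertex added last is coloured first.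
      Completes : Fin (nV G) → (Fin (nV G) → Bool) → Set
      Completes a R = ∀ φ → IsSection φ → (∀ e → Hit e φ → ∃ λ v → inc G e v ≡ true × R v ≡ true) →
        ∃ λ ψ → IsSection ψ × AlmostProper a ψ × (∀ v → R v ≡ false → ψ v ≡ φ v)

      -- While `u` is being coloured, `e₀` still has the uncoloured vertex `r`. Only the other edges
      -- at `u` can forbid a colour, and they are fewer than the colours.
      completes-step : ∀ {a} R u r → Adj G u r → R r ≡ true → Completes a R →
        Completes a (λ v → R v ∨ (v ==ᶠ u))
      completes-step {a} R u r (e₀ , u∈e₀ , r∈e₀) Rr comp φ sφ proper
        with choose φ u ((λ e → inc G e u) ∖ e₀)
               (≤-trans (≤-reflexive (count-∖ (λ e → inc G e u) e₀ u∈e₀)) (deg≤ u))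
      ... | x , px , ok with comp (upd φ u x) (section-upd sφ px) proper'
        where
        proper' : ∀ e → Hit e (upd φ u x) → ∃ λ v → inc G e v ≡ true × R v ≡ true
        proper' e h with inc G e u ≟ᵇ true | e ≟ e₀
        ... | yes u∈e | yes refl = r , r∈e₀ , Rr
        ... | yes u∈e | no e≢ = contradiction h (ok e (∖⁺ (λ e → inc G e u) u∈e e≢) u∈e)
        ... | no u∉e | _ with proper e (hit-upd⁻ u∉e h)
        ...   | v , v∈e , Rv with ∨-split Rv
        ...     | inj₁ Rv = v , v∈e , Rv
        ...     | inj₂ q = contradiction (subst (λ z → inc G e z ≡ true) (==ᶠ⇒≡ q) v∈e) u∉e
      ...   | ψ , sψ , ap , agree = ψ , sψ , ap , λ v Rv →
              trans (agree v (proj₁ (∨-false Rv))) (upd-other φ (==ᶠ⇒≢ (proj₂ (∨-false {R v} Rv))))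

      completes-grow : ∀ {a S} k R → count (λ v → not (R v)) ≤ k → R a ≡ true →
        (∀ v → R v ≡ true → S v ≡ false) → ConnAv G S a → Completes a R →
        Completes a (λ v → not (S v))
      completes-grow {a} {S} k R le Ra RS conn comp with any? (λ y → (S y ≟ᵇ false) ×-dec (R y ≟ᵇ false))
      ... | no none = λ φ sφ proper →
        let ψ , sψ , ap , agree = comp φ sφ λ e h → let v , v∈e , q = proper e h in v , v∈e , inR v (not-true q)
        in ψ , sψ , ap , λ v q → agree v (notR v q)
        where
        inR : ∀ v → S v ≡ false → R v ≡ true
        inR v Sv with R v in Rv
        ... | true = refl
        ... | false = contradiction (v , Sv , Rv) none
        notR : ∀ v → not (S v) ≡ false → R v ≡ false
        notR v q = not-false λ Rv → true≢false (cong not (RS v Rv)) q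
      ... | yes (y , Sy , Ry) with crossing G R (conn y Sy) Ry Ra
      ...   | u , r , Su , Ru , Rr , ur with k
      ...     | zero = contradiction (count>0 (λ v → not (R v)) (cong not Ru)) (ℕₚ.≤⇒≯ le)
      ...     | suc k' = completes-grow k' R' (s≤s⁻¹ (≤-trans lt le)) (cong (_∨ _) Ra) RS' conn
                           (completes-step R u r ur Rr comp)
        where
        R' : Fin (nV G) → Bool
        R' v = R v ∨ (v ==ᶠ u)
        lt : count (λ v → not (R' v)) < count (λ v → not (R v))
        lt = count-mono-< _ _ u (cong not Ru) (cong not (trans (cong (_∨ _) Ru) (==ᶠ⇐≡ {a = u} refl)))
               (λ x q → cong not (proj₁ (∨-false {R x} (not-true q))))
        RS' : ∀ v → R' v ≡ true → S v ≡ false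
        RS' v q with ∨-split {R v} q
        ... | inj₁ Rv = RS v Rv
        ... | inj₂ v≡u = trans (cong S (==ᶠ⇒≡ v≡u)) Su

    extend : ∀ {a S} → S a ≡ false → ConnAv G S a → ∀ φ → IsSection φ → Proper S φ →
      ∃ λ ψ → IsSection ψ × AlmostProper a ψ × (∀ v → S v ≡ true → ψ v ≡ φ v)
    extend {a} {S} Sa conn φ sφ proper
      with completes-grow (count {nV G} _) (_==ᶠ a) ≤-refl (==ᶠ⇐≡ {a = a} refl)
             (λ v q → trans (cong S (==ᶠ⇒≡ q)) Sa) conn start φ sφ
             (λ e h → let v , v∈e , q = proper e h in v , v∈e , cong not q)
      where
      start : Completes a (_==ᶠ a)
      start φ sφ proper = φ , sφ , (λ e h → let v , v∈e , q = proper e h in subst (λ z → inc G e z ≡ true) (==ᶠ⇒≡ q) v∈e) , λ _ _ → refl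
    ... | ψ , sψ , ap , agree = ψ , sψ , ap , λ v q → agree v (cong not q)

    -- Rigidity of an uncolourable cover

    module Uncolorable (unc : ¬ ∃ λ φ → IsSection φ × (∀ e → ¬ Hit e φ))
                       (φ₀ : Selection) (sφ₀ : IsSection φ₀)
                       (conn : ∀ a → ConnAv G ∅ a) where

      blocker : ∀ {φ v} → IsSection φ → AlmostProper v φ → ∀ x → p C x ≡ v →
        ∃ λ e → inc G e v ≡ true × Hit e (upd φ v x)
      blocker {φ} {v} sφ ap x px with any? (λ e → hit? e (upd φ v x))
      ... | no none = contradiction (upd φ v x , section-upd sφ px , λ e h → none (e , h)) unc
      ... | yes (e , h) with inc G e v ≟ᵇ true
      ...   | yes v∈e = e , v∈e , h
      ...   | no v∉e = contradiction (ap e (hit-upd⁻ v∉e h)) v∉e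

      -- If `e` forbade nothing, the other edges at `v`, fewer than the colours there, would have to
      -- forbid every colour.
      tight : ∀ {φ v} → IsSection φ → AlmostProper v φ → ∀ e → inc G e v ≡ true →
        ∃ λ x → p C x ≡ v × Hit e (upd φ v x)
      tight {φ} {v} sφ ap e v∈e with any? (λ x → (p C x ≟ v) ×-dec hit? e (upd φ v x))
      ... | yes r = r
      ... | no none = contradiction
        (≤-trans (≤-reflexive (count-∖ (λ f → inc G f v) e v∈e)) (deg≤ v))
        (ℕₚ.≤⇒≯ (blocked-count φ v ((λ f → inc G f v) ∖ e) λ x px →
          let f , v∈f , h = blocker sφ ap x px
          in f , ∖⁺ (λ f → inc G f v) v∈f (λ { refl → none (x , px , h) }) , v∈f , h))

      -- The only colour that `f` forbids would be `x`, which `e` forbids as well; so the edges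
      -- other than `f` would already forbid every colour at `v`.
      tight-distinct : ∀ {φ v} → IsSection φ → AlmostProper v φ → ∀ {e f x} → inc G e v ≡ true →
        inc G f v ≡ true → e ≢ f → p C x ≡ v → Hit e (upd φ v x) → ¬ Hit f (upd φ v x)
      tight-distinct {φ} {v} sφ ap {e} {f} {x} v∈e v∈f e≢f px he hf = contradiction
        (≤-trans (≤-reflexive (count-∖ (λ g → inc G g v) f v∈f)) (deg≤ v))
        (ℕₚ.≤⇒≯ (blocked-count φ v ((λ g → inc G g v) ∖ f) pick))
        where
        pick : ∀ y → p C y ≡ v → ∃ λ g → ((λ g → inc G g v) ∖ f) g ≡ true × inc G g v ≡ true × Hit g (upd φ v y)
        pick y py with blocker sφ ap y py
        ... | g , v∈g , h with g ≟ f
        ...   | no g≢f = g , ∖⁺ (λ g → inc G g v) v∈g g≢f , v∈g , h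
        ...   | yes refl with hit-unique v∈f py px h hf
        ...     | refl = e , ∖⁺ (λ g → inc G g v) v∈e e≢f , v∈e , he

      almostProper : ∀ a → ∃ λ φ → IsSection φ × AlmostProper a φ
      almostProper a with extend refl (conn a) φ₀ sφ₀ (λ e h → let v , v∈e , _ = other G e a in v , v∈e , refl)
      ... | ψ , sψ , ap , _ = ψ , sψ , ap

      fiberSize≤degree : ∀ v → fiberSize C v ≤ degree G v
      fiberSize≤degree v with almostProper v
      ... | φ , sφ , ap = blocked-count φ v (λ e → inc G e v) λ x px → let e , v∈e , h = blocker sφ ap x px in e , v∈e , v∈e , h

      -- A coloured vertex of an edge at `a` leaves only one colour that the edge can forbid at `a`.
      -- For `e` and `f` this colour is `x`, against `tight-distinct`.
      clash : ∀ {a S} → S a ≡ false → ConnAv G S a → ∀ φ → IsSection φ → Proper S φ → ∀ {e f u w x} →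
        e ≢ f → inc G e a ≡ true → inc G f a ≡ true → inc G e u ≡ true → inc G f w ≡ true →
        S u ≡ true → S w ≡ true → p C x ≡ a → Linked e (φ u) x → Linked f (φ w) x → ⊥
      clash {a} {S} Sa con φ sφ pr {e} {f} {u} {w} {x} e≢f ae af ue wf Su Sw px lu lw
        with extend Sa con φ sφ pr
      ... | ψ , sψ , ap , agree with tight sψ ap e ae | tight sψ ap f af
      ...   | y , py , hy | z , pz , hz = tight-distinct sψ ap ae af e≢f px
                (subst (λ t → Hit e (upd ψ a t)) (same ue Su hy ae py lu) hy)
                (subst (λ t → Hit f (upd ψ a t)) (same wf Sw hz af pz lw) hz)
        where
        same : ∀ {g t y} → inc G g t ≡ true → S t ≡ true → Hit g (upd ψ a y) → inc G g a ≡ true → p C y ≡ a →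
          Linked g (φ t) x → y ≡ x
        same {g} {t} {y} tg St h ag py l = linked-unique
          (subst (λ c → Linked g c y) (agree t St) (hit-linked-upd h ag tg λ { refl → true≢false St Sa }))
          l (trans py (sym px))

      proper-single : ∀ u φ → Proper ⁅ u ⁆ φ
      proper-single u φ e _ = let v , v∈e , v≢u = other G e u in v , v∈e , ==ᶠ⇐≢ v≢u

      recolor₀ : ∀ u x → p C x ≡ u → ∃ λ φ → IsSection φ × φ u ≡ x
      recolor₀ u x px = upd φ₀ u x , section-upd sφ₀ px , upd-same φ₀

      -- With `u` precoloured by `x` and the rest completed towards `w`, tightness makes `e` forbid
      -- some colour at `w`, and the matching edge responsible passes through `x`.
      linked-total : ∀ {e u w} → inc G e u ≡ true → inc G e w ≡ true → u ≢ w → ConnAv G ⁅ u ⁆ w →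
        ∀ x → p C x ≡ u → ∃ λ y → p C y ≡ w × Linked e x y
      linked-total {e} {u} {w} ue we u≢w con x px with recolor₀ u x px
      ... | φ , sφ , refl with extend (==ᶠ⇐≢ λ r → u≢w (sym r)) con φ sφ (proper-single u φ)
      ...   | ψ , sψ , ap , agree with tight sψ ap e we
      ...     | y , py , h = y , py , subst (λ c → Linked e c y) (agree u (==ᶠ⇐≡ {a = u} refl)) (hit-linked-upd h we ue u≢w)

      -- With `u` precoloured by `x`, both edges would forbid `y` at `w`.
      linked-disjoint : ∀ {e f u w x y} → e ≢ f → inc G e u ≡ true → inc G e w ≡ true → inc G f u ≡ true →
        inc G f w ≡ true → u ≢ w → ConnAv G ⁅ u ⁆ w → p C x ≡ u → p C y ≡ w → Linked e x y → ¬ Linked f x y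
      linked-disjoint {u = u} {w} {x} e≢f ue we uf wf u≢w con px py le lf with recolor₀ u x px
      ... | φ , sφ , refl = clash (==ᶠ⇐≢ λ r → u≢w (sym r)) con φ sφ (proper-single u φ) e≢f we wf ue uf
              (==ᶠ⇐≡ {a = u} refl) (==ᶠ⇐≡ {a = u} refl) py le lf

      InsideHit : (Fin (nV G) → Bool) → Selection → Set
      InsideHit S φ = ∃ λ g → (∀ v → inc G g v ≡ true → S v ≡ true) × Hit g φ

      insideHit? : ∀ S φ → Dec (InsideHit S φ)
      insideHit? S φ = any? λ g → (all? λ v → (inc G g v ≟ᵇ true) →-dec (S v ≟ᵇ true)) ×-dec hit? g φ

      ¬insideHit⇒proper : ∀ {S φ} → ¬ InsideHit S φ → Proper S φ
      ¬insideHit⇒proper {S} {φ} none g h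
        with any? (λ v → (inc G g v ≟ᵇ true) ×-dec (S v ≟ᵇ false))
      ... | yes r = r
      ... | no out = contradiction (g , (λ v v∈g → decidable-stable (S v ≟ᵇ true) λ q → out (v , v∈g , not-false q)) , h) none

      -- z can be given a second colour without touching the colours of the rest of S, because
      -- both e and f leave S; but e determines the colour of z from that of x.
      recolor-hyperedge : ∀ {S a e f z x r} → e ≢ f → inc G e a ≡ true → inc G e z ≡ true → inc G e x ≡ true → x ≢ z →
        inc G f z ≡ true → inc G f r ≡ true → S z ≡ true → S x ≡ true → S a ≡ false → S r ≡ false →
        ConnAv G S a → ⊥
      recolor-hyperedge {S} {a} {e} {f} {z} {x} {r} e≢f ae ze xe x≢z zf rf Sz Sx Sa Sr con
        with almostProper a
      ... | φ , sφ , ap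
        with any? (λ y → (p C y ≟ z) ×-dec (¬? (y ≟ φ z) ×-dec ¬? (insideHit? S (upd φ z y))))
      ...   | yes (y , py , y≢ , ok) with extend Sa con (upd φ z y) (section-upd sφ py) (¬insideHit⇒proper ok)
      -- Tightness of `e` at `a` under both colourings puts both colours of `z` on the matching edge
      -- of `e` through the one colour of `x`.
      ...     | ψ , sψ , ap' , agree with tight sφ ap e ae | tight sψ ap' e ae
      ...       | b , _ , hb | c , _ , hc = y≢ (linked-unique lψ (linked-sym lφ) (trans py (sym (sφ z))))
        where
        ≢a : ∀ {v} → S v ≡ true → v ≢ a
        ≢a Sv refl = true≢false Sv Sa
        lφ : Linked e (φ z) (φ x)
        lφ = subst₂ (Linked e) (upd-other φ (≢a Sz)) (upd-other φ (≢a Sx)) (hit-linked hb ze xe)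
        ψz : upd ψ a c z ≡ y
        ψz = trans (upd-other ψ (≢a Sz)) (trans (agree z Sz) (upd-same φ))
        ψx : upd ψ a c x ≡ φ x
        ψx = trans (upd-other ψ (≢a Sx)) (trans (agree x Sx) (upd-other φ x≢z))
        lψ : Linked e (φ x) y
        lψ = subst₂ (Linked e) ψx ψz (hit-linked hc xe ze)
      recolor-hyperedge {S} {a} {e} {f} {z} {x} {r} e≢f ae ze xe x≢z zf rf Sz Sx Sa Sr con
          | φ , sφ , ap | no none = contradiction
        (≤-trans (≤-reflexive (count-∖ (λ g → inc G g z) e ze)) (deg≤ z))
        (ℕₚ.≤⇒≯ (count-inj _ ((λ g → inc G g z) ∖ e) B pick unique))
        where
        -- The colour `φ z` is charged to `f`, every other colour at `z` to an edge inside `S` that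
        -- blocks it. As `e` contains `a`, it is not inside `S` and is never charged, so `z` would
        -- have fewer colours than edges.
        B : Fin (N C) → Fin (nE G) → Set
        B y g = (g ≡ f × y ≡ φ z) ⊎ ((∀ v → inc G g v ≡ true → S v ≡ true) × inc G g z ≡ true × Hit g (upd φ z y))
        pick : ∀ y → (p C y ==ᶠ z) ≡ true → ∃ λ g → ((λ g → inc G g z) ∖ e) g ≡ true × B y g
        pick y py with y ≟ φ z
        ... | yes q = f , ∖⁺ (λ g → inc G g z) zf (λ r → e≢f (sym r)) , inj₁ (refl , q)
        ... | no q with decidable-stable (insideHit? S (upd φ z y)) (λ ok → none (y , ==ᶠ⇒≡ py , q , ok))
        ...   | g , inside , h with inc G g z ≟ᵇ true
        ...     | yes zg = g , ∖⁺ (λ g → inc G g z) zg (λ { refl → true≢false (inside a ae) Sa }) , inj₂ (inside , zg , h)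
        ...     | no zg = contradiction Sa (true≢false (inside a (ap g (hit-upd⁻ zg h))))
        unique : ∀ y y' g → (p C y ==ᶠ z) ≡ true → (p C y' ==ᶠ z) ≡ true → B y g → B y' g → y ≡ y'
        unique y y' g py py' (inj₁ (_ , q)) (inj₁ (_ , q')) = trans q (sym q')
        unique y y' g py py' (inj₁ (refl , _)) (inj₂ (inside , _)) = contradiction Sr (true≢false (inside r rf))
        unique y y' g py py' (inj₂ (inside , _)) (inj₁ (refl , _)) = contradiction Sr (true≢false (inside r rf))
        unique y y' g py py' (inj₂ (_ , zg , h)) (inj₂ (_ , _ , h')) = hit-unique zg (==ᶠ⇒≡ py) (==ᶠ⇒≡ py') h h'

      -- Some edge `g` at `v` misses `w` and forbids a colour `γ` at `v`. The edges joining `v` and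
      -- `w` match `γ` to pairwise different colours `y` at `w`. If `w` could take such a `y`, the
      -- edge in question would forbid `γ` along with `g`; so an edge at `w` missing `v` blocks `y`,
      -- and it blocks no other colour. Thus the edges at `w` missing `v` are at least as many as
      -- those joining `v` and `w`.
      mult-double : ∀ {v w} → v ≢ w → ConnAv G ⁅ v ⁆ w → mult G v w < degree G v →
        mult G v w + mult G v w ≤ degree G w
      mult-double {v} {w} v≢w con lt with almostProper v
      ... | φ , sφ , ap with count-pos (λ e → inc G e v ∧ not (inc G e w)) pos
        where
        pos : 0 < count (λ e → inc G e v ∧ not (inc G e w))
        pos = ℕₚ.+-cancelˡ-< (mult G v w) 0 _
          (subst₂ _<_ (sym (ℕₚ.+-identityʳ _)) (count-split (λ e → inc G e v) (λ e → inc G e w)) lt)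
      ...   | g , q with ∧-split {inc G g v} q
      ...     | vg , w∉g with tight sφ ap g vg
      ...       | γ , pγ , hγ = subst (mult G v w + mult G v w ≤_) (sym split) (ℕₚ.+-monoʳ-≤ (mult G v w) (count-inj (λ e → inc G e v ∧ inc G e w) (λ e → inc G e w ∧ not (inc G e v)) B pick unique))
        where
        split : degree G w ≡ mult G v w + count (λ e → inc G e w ∧ not (inc G e v))
        split = trans (count-split (λ e → inc G e w) (λ e → inc G e v))
          (cong (_+ count (λ e → inc G e w ∧ not (inc G e v))) (count-cong λ e → ∧-comm (inc G e w) (inc G e v)))
        g≢ : ∀ {e} → inc G e w ≡ true → e ≢ g
        g≢ we refl = true≢false we (not-true w∉g)
        B : Fin (nE G) → Fin (nE G) → Set
        B e f = inc G f w ≡ true × ∃ λ y → p C y ≡ w × Linked e γ y × Hit f (upd φ w y)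
        pick : ∀ e → inc G e v ∧ inc G e w ≡ true → ∃ λ f → inc G f w ∧ not (inc G f v) ≡ true × B e f
        pick e q with ∧-split {inc G e v} q
        ... | ve , we with linked-total ve we v≢w con γ pγ
        ...   | y , py , l with any? (λ f → ((inc G f w ≟ᵇ true) ×-dec (inc G f v ≟ᵇ false)) ×-dec hit? f (upd φ w y))
        ...     | yes (f , (wf , vf) , h) = f , ∧-join wf (cong not vf) , wf , y , py , l , h
        ...     | no none = ⊥-elim (tight-distinct sφ' ap' ve vg (g≢ we) pγ he hg)
          where
          sφ' : IsSection (upd φ w y)
          sφ' = section-upd sφ py
          ap' : AlmostProper v (upd φ w y)
          ap' f h with inc G f v in vf
          ... | true = refl
          ... | false with inc G f w ≟ᵇ true
          ...   | yes wf = contradiction (f , (wf , vf) , h) none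
          ...   | no wf = trans (sym vf) (ap f (hit-upd⁻ wf h))
          hg : Hit g (upd (upd φ w y) v γ)
          hg = hit-cong (λ u ug → same u λ { refl → true≢false ug (not-true w∉g) }) hγ
            where
            same : ∀ u → u ≢ w → upd φ v γ u ≡ upd (upd φ w y) v γ u
            same u u≢w with u ≟ v
            ... | yes refl = refl
            ... | no u≢v = sym (upd-other φ u≢w)
          he : Hit e (upd (upd φ w y) v γ)
          he with tight sφ' ap' e ve
          ... | x , px , h with linked-unique (subst (λ c → Linked e c x) (upd-same φ) (hit-linked-upd h ve we (λ r → v≢w (sym r))))
                                  (linked-sym l) (trans px (sym pγ))
          ...   | refl = h
        unique : ∀ e e' f → inc G e v ∧ inc G e w ≡ true → inc G e' v ∧ inc G e' w ≡ true → B e f → B e' f → e ≡ e'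
        unique e e' f q q' (wf , y , py , l , h) (_ , y' , py' , l' , h') with e ≟ e'
        ... | yes r = r
        ... | no e≢ with hit-unique wf py py' h h'
        ...   | refl = contradiction l' (linked-disjoint e≢ (proj₁ (∧-split q)) (proj₂ (∧-split {inc G e v} q))
                           (proj₁ (∧-split q')) (proj₂ (∧-split {inc G e' v} q')) v≢w con pγ py l)

      -- Fix a colour `α` at `a` and its partner `δ` at `d` along `f`. An edge `e` joining `a` and
      -- `b` gives a partner `β` of `α` at `b`. Colouring `b` by `β` and `d` by `δ` would let `e`
      -- and `f` both forbid `α`, so an edge joining `b` and `d` must match `δ` to `β`. That edge
      -- determines `β`, and `β` determines `e`.
      mult-triangle : Ordinary G → ∀ {a b d S} → a ≢ b → a ≢ d → b ≢ d → S b ≡ true → S d ≡ true → S a ≡ false →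
        (∀ v → S v ≡ true → v ≡ b ⊎ v ≡ d) → ConnAv G S a → ConnAv G ⁅ a ⁆ b → ConnAv G ⁅ a ⁆ d → Adj G a d →
        mult G a b ≤ mult G b d
      mult-triangle ord {a} {b} {d} {S} a≢b a≢d b≢d Sb Sd Sa Sbd con conb cond (f , af , df)
        with linked-total af df a≢d cond (φ₀ a) (sφ₀ a)
      ... | δ , pδ , lδ = count-inj _ _ B pick unique
        where
        α : Fin (N C)
        α = φ₀ a
        B : Fin (nE G) → Fin (nE G) → Set
        B e g = ∃ λ β → p C β ≡ b × Linked e α β × Linked g δ β
        pick : ∀ e → inc G e a ∧ inc G e b ≡ true → ∃ λ g → inc G g b ∧ inc G g d ≡ true × B e g
        pick e q with ∧-split {inc G e a} q
        ... | ae , be with linked-total ae be a≢b conb α (sφ₀ a)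
        ...   | β , pβ , lβ with any? (λ g → ((inc G g b ≟ᵇ true) ×-dec (inc G g d ≟ᵇ true)) ×-dec linked? g δ β)
        ...     | yes (g , (bg , dg) , l) = g , ∧-join bg dg , β , pβ , lβ , l
        ...     | no none = ⊥-elim (clash Sa con φ sφ proper e≢f ae af be df Sb Sd (sφ₀ a)
                    (linked-sym (subst (Linked e α) (sym φb) lβ)) (linked-sym (subst (Linked f α) (sym φd) lδ)))
          where
          φ : Selection
          φ = upd (upd φ₀ b β) d δ
          sφ : IsSection φ
          sφ = section-upd (section-upd sφ₀ pβ) pδ
          φd : φ d ≡ δ
          φd = upd-same (upd φ₀ b β) {d}
          φb : φ b ≡ β
          φb = trans (upd-other (upd φ₀ b β) b≢d) (upd-same φ₀)
          e≢f : e ≢ f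
          e≢f refl with count-2-exhaust (inc G e) (ord e) ae be a≢b df
          ... | inj₁ r = a≢d (sym r)
          ... | inj₂ r = b≢d (sym r)
          proper : Proper S φ
          proper g h with other G g b | other G g d
          ... | u , ug , u≢b | w , wg , w≢d with S u in Su | S w in Sw
          ...   | false | _ = u , ug , Su
          ...   | true | false = w , wg , Sw
          ...   | true | true with Sbd u Su | Sbd w Sw
          ...     | inj₁ r | _ = contradiction r u≢b
          ...     | inj₂ _ | inj₂ r = contradiction r w≢d
          ...     | inj₂ refl | inj₁ refl = contradiction (g , (wg , ug) , subst₂ (Linked g) φd φb (hit-linked h ug wg)) none
        unique : ∀ e e' g → inc G e a ∧ inc G e b ≡ true → inc G e' a ∧ inc G e' b ≡ true → B e g → B e' g → e ≡ e'
        unique e e' g q q' (β , pβ , l , lg) (β' , pβ' , l' , lg') with e ≟ e'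
        ... | yes r = r
        ... | no e≢ with linked-unique lg lg' (trans pβ (sym pβ'))
        ...   | refl = contradiction l' (linked-disjoint e≢ (proj₁ (∧-split q)) (proj₂ (∧-split {inc G e a} q))
                         (proj₁ (∧-split q')) (proj₂ (∧-split {inc G e' a} q')) a≢b conb (sφ₀ a) pβ l)

      -- u has neighbours only off S, while w has one in S: colour S first, then u so that e and g
      -- forbid the same colour at w, and finish greedily towards w.
      closed-neighbour : ∀ {S u w e g x} → u ≢ w → inc G e u ≡ true → inc G e w ≡ true → inc G g w ≡ true →
        inc G g x ≡ true → x ≢ u → S u ≡ true → S x ≡ true → S w ≡ false →
        (∀ f v → inc G f u ≡ true → inc G f v ≡ true → S v ≡ true → v ≡ u) →
        ConnAv G S w → ConnAv G ⁅ u ⁆ w → degree G w ≤ degree G u → ⊥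
      closed-neighbour {S} {u} {w} {e} {g} {x} u≢w ue we wg xg x≢u Su Sx Sw closed con conu deg
        with almostProper w
      ... | ψ , sψ , ap with tight sψ ap g wg
      ...   | α , pα , hα with any? (λ y → (p C y ≟ u) ×-dec linked? e y α)
      ...     | yes (β , pβ , l) = clash Sw con (upd ψ u β) (section-upd sψ pβ) proper e≢g we wg ue xg Su Sx pα
                  (subst (λ c → Linked e c α) (sym (upd-same ψ)) l)
                  (subst (λ c → Linked g c α) (sym (upd-other ψ x≢u)) (hit-linked-upd hα wg xg λ { refl → true≢false Sx Sw }))
        where
        e≢g : e ≢ g
        e≢g refl = x≢u (closed e x ue xg Sx)
        proper : Proper S (upd ψ u β)
        proper f h with inc G f u ≟ᵇ true
        ... | no uf = w , ap f (hit-upd⁻ uf h) , Sw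
        ... | yes uf with other G f u
        ...   | v , vf , v≢u = v , vf , not-false λ Sv → v≢u (closed f v uf vf Sv)
      -- Otherwise `e` maps the colours at `u` injectively into those at `w` other than `α`,
      -- although `u` has at least `degree G u` colours and `w` at most `degree G w`.
      ...     | no none = contradiction
        (≤-trans (≤-reflexive (count-∖ Xw α (==ᶠ⇐≡ pα))) (≤-trans (fiberSize≤degree w) (≤-trans deg (deg≤ u))))
        (ℕₚ.≤⇒≯ (count-inj _ (Xw ∖ α) (λ y z → p C z ≡ w × Linked e y z) pick unique))
        where
        Xw : Fin (N C) → Bool
        Xw y = p C y ==ᶠ w
        pick : ∀ y → (p C y ==ᶠ u) ≡ true → ∃ λ z → (Xw ∖ α) z ≡ true × p C z ≡ w × Linked e y z
        pick y py with linked-total ue we u≢w conu y (==ᶠ⇒≡ py)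
        ... | z , pz , l = z , ∖⁺ Xw (==ᶠ⇐≡ pz) (λ { refl → none (y , ==ᶠ⇒≡ py , l) }) , pz , l
        unique : ∀ y y' z → (p C y ==ᶠ u) ≡ true → (p C y' ==ᶠ u) ≡ true → p C z ≡ w × Linked e y z → p C z ≡ w × Linked e y' z → y ≡ y'
        unique y y' z py py' (_ , l) (_ , l') = linked-unique (linked-sym l) (linked-sym l') (trans (==ᶠ⇒≡ py) (sym (==ᶠ⇒≡ py')))

-- Deciding colourability, and the upper bound

degree≤Δ : ∀ G v → degree G v ≤ Δ G
degree≤Δ G v = maxOver-upper (degree G) v

connAv-∅ : ∀ {G} → Connected G → ∀ a → ConnAv G ∅ a
connAv-∅ {G} conn a y _ with conn y a
... | q , vs , es , _ , _ , refl , refl , step = walk q vs es step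
  where
  walk : ∀ q (vs : Fin (suc q) → Fin (nV G)) (es : Fin q → Fin (nE G)) →
    (∀ j → inc G (es j) (vs (inject₁ j)) ≡ true × inc G (es j) (vs (fsuc j)) ≡ true) →
    Star (AdjAv G ∅) (vs fzero) (vs (fromℕ q))
  walk zero vs es step = ε
  walk (suc q) vs es step = (refl , refl , es fzero , step fzero) ◅
    walk q (λ j → vs (fsuc j)) (λ j → es (fsuc j)) (λ j → step (fsuc j))

module _ {G : Hypergraph} (C : Cover G) where

  colorable? : Dec (Colorable C)
  colorable? = map′ (λ (s , ok) → lookup s , ok)
    (λ (T , sec , ind) → tabulate T , (λ v → trans (count-cong λ x → cong (_∧ _) (lookup∘tabulate T x)) (sec v)) ,
      λ e j all → ind e j λ x q → trans (sym (lookup∘tabulate T x)) (all x q))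
    (anySubset? λ s → (all? λ v → count (λ x → lookup s x ∧ (p C x ==ᶠ v)) ℕₚ.≟ 1) ×-dec
      (all? λ e → all? λ j → ¬? (all? λ x → (M C e j x ≟ᵇ true) →-dec (lookup s x ≟ᵇ true))))

  unhit⇒colorable : (∃ λ φ → IsSection C φ × (∀ e → ¬ Hit C e φ)) → Colorable C
  unhit⇒colorable (φ , sφ , unhit) = T , transversal , independent
    where
    T : Fin (N C) → Bool
    T x = x ==ᶠ φ (p C x)
    transversal : ∀ v → count (λ x → T x ∧ (p C x ==ᶠ v)) ≡ 1
    transversal v = count-≡1 _ (φ v) (∧-join (==ᶠ⇐≡ (cong φ (sym (sφ v)))) (==ᶠ⇐≡ (sφ v)))
      λ x q → let a , b = ∧-split {T x} q in trans (==ᶠ⇒≡ a) (cong φ (==ᶠ⇒≡ b))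
    independent : ∀ e j → ¬ (∀ x → M C e j x ≡ true → T x ≡ true)
    independent e j sub = unhit e (j , λ u u∈e →
      let x , q = count-pos (λ x → M C e j x ∧ (p C x ==ᶠ u)) (≤-reflexive (sym (M-meets C e j u u∈e)))
          Mx , px = ∧-split {M C e j x} q
      in subst (λ z → M C e j z ≡ true) (trans (==ᶠ⇒≡ (sub x Mx)) (cong φ (==ᶠ⇒≡ px))) Mx)

  sections : (∀ v → 0 < fiberSize C v) → ∃ λ φ → IsSection C φ
  sections pos = (λ v → proj₁ (pick v)) , λ v → ==ᶠ⇒≡ (proj₂ (pick v))
    where
    pick : ∀ v → ∃ λ x → (p C x ==ᶠ v) ≡ true
    pick v = count-pos _ (pos v)

  colorable-by-degree : (∀ v → degree G v < fiberSize C v) → Colorable C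
  colorable-by-degree big with sections (λ v → ≤-trans (s≤s z≤n) (big v))
  ... | φ₀ , sφ₀ = unhit⇒colorable (greedy (nV G) (λ _ → true) (≤-reflexive (count-all (nV G))) φ₀ sφ₀ (λ e _ → let v , v∈e = vertex e in v , v∈e , refl))
    where
    vertex : ∀ e → ∃ λ v → inc G e v ≡ true
    vertex e = count-pos (inc G e) (≤-trans (s≤s z≤n) (size G e))
    greedy : ∀ k (R : Fin (nV G) → Bool) → count R ≤ k → ∀ φ → IsSection C φ → (∀ e → Hit C e φ → ∃ λ v → inc G e v ≡ true × R v ≡ true) →
      ∃ λ φ → IsSection C φ × (∀ e → ¬ Hit C e φ)
    greedy k R le φ sφ ok with any? (λ v → R v ≟ᵇ true)
    ... | no none = φ , sφ , λ e h → let v , _ , Rv = ok e h in none (v , Rv)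
    greedy zero R le φ sφ ok | yes (v , Rv) = contradiction (count>0 R Rv) (ℕₚ.≤⇒≯ le)
    greedy (suc k) R le φ sφ ok | yes (v , Rv) with choose C φ v (λ e → inc G e v) (big v)
    ... | x , px , free = greedy k (R ∖ v) (s≤s⁻¹ (≤-trans (≤-reflexive (count-∖ R v Rv)) le)) (upd φ v x) (section-upd C sφ px) ok'
      where
      ok' : ∀ e → Hit C e (upd φ v x) → ∃ λ u → inc G e u ≡ true × (R ∖ v) u ≡ true
      ok' e h with inc G e v ≟ᵇ true
      ... | yes v∈e = contradiction h (free e v∈e v∈e)
      ... | no v∉e with ok e (hit-upd⁻ C v∉e h)
      ...   | u , u∈e , Ru = u , u∈e , ∖⁺ R Ru λ { refl → v∉e u∈e }

DPColorable-suc-Δ : ∀ G → DPColorable G (suc (Δ G))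
DPColorable-suc-Δ G C big = colorable-by-degree C λ v → ≤-trans (s≤s (degree≤Δ G v)) (big v)

-- The consequences of not being Δ-DP-colorable are decidable or negative, so that they can be
-- drawn although no uncolorable cover can be exhibited constructively.
module Critical (G : Hypergraph) (conn : Connected G) (0<Δ : 0 < Δ G) (¬col : ¬ DPColorable G (Δ G)) where

  module U (C : Cover G) (big : ∀ v → Δ G ≤ fiberSize C v) (unc : ¬ Colorable C) =
    Uncolorable C (λ v → ≤-trans (degree≤Δ G v) (big v)) (λ s → unc (unhit⇒colorable C s))
      (proj₁ (sections C λ v → ≤-trans 0<Δ (big v))) (proj₂ (sections C λ v → ≤-trans 0<Δ (big v))) (connAv-∅ {G} conn)

  refute : ((C : Cover G) → (∀ v → Δ G ≤ fiberSize C v) → ¬ Colorable C → ⊥) → ⊥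
  refute h = ¬col λ C big → decidable-stable (colorable? C) (h C big)

  regular : ∀ v → degree G v ≡ Δ G
  regular v = decidable-stable (_ ℕₚ.≟ _) λ ne → refute λ C big unc →
    ne (≤-antisym (degree≤Δ G v) (≤-trans (big v) (U.fiberSize≤degree C big unc v)))

  recolor-hyperedge : ∀ {S a e f z x r} → e ≢ f → inc G e a ≡ true → inc G e z ≡ true → inc G e x ≡ true → x ≢ z →
    inc G f z ≡ true → inc G f r ≡ true → S z ≡ true → S x ≡ true → S a ≡ false → S r ≡ false →
    ConnAv G S a → ⊥
  recolor-hyperedge e≢f ae ze xe x≢z zf rf Sz Sx Sa Sr con = refute λ C big unc →
    U.recolor-hyperedge C big unc e≢f ae ze xe x≢z zf rf Sz Sx Sa Sr con

  mult-double : ∀ {v w} → v ≢ w → ConnAv G ⁅ v ⁆ w → mult G v w < degree G v → mult G v w + mult G v w ≤ Δ G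
  mult-double {v} {w} v≢w con lt = decidable-stable (_ ≤? _) λ nle → refute λ C big unc →
    nle (≤-trans (U.mult-double C big unc v≢w con lt) (degree≤Δ G w))

  mult-triangle : Ordinary G → ∀ {a b d S} → a ≢ b → a ≢ d → b ≢ d → S b ≡ true → S d ≡ true → S a ≡ false →
    (∀ v → S v ≡ true → v ≡ b ⊎ v ≡ d) → ConnAv G S a → ConnAv G ⁅ a ⁆ b → ConnAv G ⁅ a ⁆ d → Adj G a d →
    mult G a b ≤ mult G b d
  mult-triangle ord a≢b a≢d b≢d Sb Sd Sa Sbd con conb cond ad = decidable-stable (_ ≤? _) λ nle → refute λ C big unc →
    nle (U.mult-triangle C big unc ord a≢b a≢d b≢d Sb Sd Sa Sbd con conb cond ad)

  closed-neighbour : ∀ {S u w e g x} → u ≢ w → inc G e u ≡ true → inc G e w ≡ true → inc G g w ≡ true →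
    inc G g x ≡ true → x ≢ u → S u ≡ true → S x ≡ true → S w ≡ false →
    (∀ f v → inc G f u ≡ true → inc G f v ≡ true → S v ≡ true → v ≡ u) →
    ConnAv G S w → ConnAv G ⁅ u ⁆ w → ⊥
  closed-neighbour {u = u} {w} u≢w ue we wg xg x≢u Su Sx Sw closed con conu = refute λ C big unc →
    U.closed-neighbour C big unc u≢w ue we wg xg x≢u Su Sx Sw closed con conu
      (≤-reflexive (trans (regular w) (sym (regular u))))

-- Hamilton cycles

predecessor : 0 < m → ∃ λ n → suc n ≡ m
predecessor {suc n} _ = n , refl

does-sound : ∀ {A : Set} (d : Dec A) → does d ≡ true → A
does-sound (yes a) _ = a

largest : ∀ {Q : ℕ → Set} → Decidable Q → ∀ k {i} → i ≤ k → Q i →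
  ∃ λ j → j ≤ k × Q j × (∀ i → i ≤ k → Q i → i ≤ j)
largest Q? zero z≤n q = zero , z≤n , q , λ _ le _ → le
largest Q? (suc k) {i} le q with Q? (suc k)
... | yes q' = suc k , ≤-refl , q' , λ _ le _ → le
... | no nq with ℕₚ.m≤n⇒m<n∨m≡n le
...   | inj₂ refl = contradiction q nq
...   | inj₁ lt with largest Q? k (s≤s⁻¹ lt) q
...     | j , j≤k , qj , mx = j , ℕₚ.m≤n⇒m≤1+n j≤k , qj , mx'
  where
  mx' : ∀ i → i ≤ suc k → _ → i ≤ j
  mx' i le q with ℕₚ.m≤n⇒m<n∨m≡n le
  ... | inj₂ refl = contradiction q nq
  ... | inj₁ lt = mx i (s≤s⁻¹ lt) q

first-change : ∀ {Q : ℕ → Set} → Decidable Q → ¬ Q 0 → ∀ i → Q i → ∃ λ j → suc j ≤ i × ¬ Q j × Q (suc j)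
first-change Q? nq0 zero q = contradiction q nq0
first-change Q? nq0 (suc i) q with Q? i
... | no nq = i , ≤-refl , nq , q
... | yes q' with first-change Q? nq0 i q'
...   | j , le , r = j , ℕₚ.m≤n⇒m≤1+n le , r

module _ {G : Hypergraph} where

  private
    V : Set
    V = Fin (nV G)

  adjAv-sym : ∀ {S u v} → AdjAv G S u v → AdjAv G S v u
  adjAv-sym (Su , Sv , uv) = Sv , Su , Adj-sym G uv

  walk-down : ∀ {S} (P : ℕ → V) {a} b → a ≤ b → (∀ i → a ≤ i → i ≤ b → S (P i) ≡ false) →
    (∀ i → a ≤ i → i < b → Adj G (P i) (P (suc i))) → Star (AdjAv G S) (P b) (P a)
  walk-down P b le Sf st with ℕₚ.m≤n⇒m<n∨m≡n le
  ... | inj₂ refl = ε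
  walk-down P (suc b) le Sf st | inj₁ lt =
    (Sf (suc b) le ≤-refl , Sf b (s≤s⁻¹ lt) (ℕₚ.n≤1+n b) , Adj-sym G (st b (s≤s⁻¹ lt) ≤-refl))
    ◅ walk-down P b (s≤s⁻¹ lt) (λ i p q → Sf i p (ℕₚ.m≤n⇒m≤1+n q)) (λ i p q → st i p (ℕₚ.m≤n⇒m≤1+n q))

  walk-up : ∀ {S} (P : ℕ → V) {a} b → a ≤ b → (∀ i → a ≤ i → i ≤ b → S (P i) ≡ false) →
    (∀ i → a ≤ i → i < b → Adj G (P i) (P (suc i))) → Star (AdjAv G S) (P a) (P b)
  walk-up P b le Sf st = Star.reverse adjAv-sym (walk-down P b le Sf st)

  mult-sym : ∀ u v → mult G u v ≡ mult G v u
  mult-sym u v = count-cong λ e → ∧-comm (inc G e u) (inc G e v)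

  adj⇒mult>0 : ∀ {u v} → Adj G u v → 0 < mult G u v
  adj⇒mult>0 (e , ue , ve) = count>0 (λ e → inc G e _ ∧ inc G e _) (∧-join ue ve)

  mult>0⇒adj : ∀ {u v} → 0 < mult G u v → Adj G u v
  mult>0⇒adj lt = let e , q = count-pos _ lt in e , ∧-split q

  prepend : V → (ℕ → V) → ℕ → V
  prepend x P zero = x
  prepend x P (suc i) = P i

  record Path (k : ℕ) : Set where
    field
      at : ℕ → V
      distinct : ∀ {i j} → i ≤ k → j ≤ k → at i ≡ at j → i ≡ j
      step : ∀ i → i < k → Adj G (at i) (at (suc i))

  open Path

  on? : (P : ℕ → V) (k : ℕ) (v : V) → Dec (∃ λ i → i < suc k × P i ≡ v)
  on? P k v = anyUpTo? (λ i → P i ≟ v) (suc k)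

  path-short : ∀ {k} → Path k → suc k ≤ nV G
  path-short {k} P = injective⇒≤ {f = λ (i : Fin (suc k)) → at P (toℕ i)}
    λ {i} {j} q → toℕ-injective (distinct P (s≤s⁻¹ (toℕ<n i)) (s≤s⁻¹ (toℕ<n j)) q)

  -- The path grows at its front, so it becomes maximal at index 0; `f` bounds the extensions still
  -- possible, as a path has at most `nV G` vertices.
  maximal-path : ∀ f k → nV G ≤ k + f → Path k →
    ∃ λ k → Σ (Path k) λ P → ∀ y → Adj G (at P 0) y → ∃ λ i → i < suc k × at P i ≡ y
  maximal-path f k le P with any? (λ y → Adj? G (at P 0) y ×-dec ¬? (on? (at P) k y))
  ... | no none = k , P , λ y a → decidable-stable (on? (at P) k y) λ off → none (y , a , off)
  maximal-path zero k le P | yes _ = contradiction (≤-trans (path-short P) (subst (nV G ≤_) (ℕₚ.+-identityʳ k) le)) (ℕₚ.<-irrefl refl)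
  maximal-path (suc f) k le P | yes (y , ay , off) = maximal-path f (suc k) (subst (nV G ≤_) (ℕₚ.+-suc k f) le) P'
    where
    distinct' : ∀ {i j} → i ≤ suc k → j ≤ suc k → prepend y (at P) i ≡ prepend y (at P) j → i ≡ j
    distinct' {zero} {zero} _ _ _ = refl
    distinct' {zero} {suc j} _ p q = contradiction (j , p , sym q) off
    distinct' {suc i} {zero} p _ q = contradiction (i , p , q) off
    distinct' {suc i} {suc j} p p' q = cong suc (distinct P (s≤s⁻¹ p) (s≤s⁻¹ p') q)
    step' : ∀ i → i < suc k → Adj G (prepend y (at P) i) (prepend y (at P) (suc i))
    step' zero _ = Adj-sym G ay
    step' (suc i) p = step P i (s≤s⁻¹ p)
    P' : Path (suc k)
    P' = record { at = prepend y (at P) ; distinct = distinct' ; step = step' }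

-- Indexing by all natural numbers with a period turns rotation into a shift of the index and avoids
-- reduction modulo `nV G`.
record HamiltonCycle (G : Hypergraph) : Set where
  field
    c : ℕ → Fin (nV G)
    step : ∀ i → Adj G (c i) (c (suc i))
    period : ∀ i → c (i + nV G) ≡ c i
    covers : ∀ v → ∃ λ i → i < nV G × c i ≡ v
    distinct : ∀ {i j} → i < nV G → j < nV G → c i ≡ c j → i ≡ j

module _ {G : Hypergraph} (H : HamiltonCycle G) where
  open HamiltonCycle H

  private
    wrap : ∀ {i} k → suc i ≡ nV G → c (i + suc k) ≡ c k
    wrap {i} k q = begin
      c (i + suc k)  ≡⟨ cong c (ℕₚ.+-suc i k) ⟩
      c (suc i + k)  ≡⟨ cong (λ t → c (t + k)) q ⟩
      c (nV G + k)   ≡⟨ cong c (ℕₚ.+-comm (nV G) k) ⟩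
      c (k + nV G)   ≡⟨ period k ⟩
      c k            ∎
      where open ≡-Reasoning

    covers-from : ∀ k v → ∃ λ i → i < nV G × c (i + k) ≡ v
    covers-from zero v = let i , lt , q = covers v in i , lt , trans (cong c (ℕₚ.+-identityʳ i)) q
    covers-from (suc k) v with covers-from k v
    ... | suc i , lt , q = i , ≤-trans (ℕₚ.n≤1+n _) lt , trans (cong c (ℕₚ.+-suc i k)) q
    ... | zero , lt , q with predecessor lt
    ...   | i , r = i , ≤-reflexive r , trans (wrap k r) q

    distinct-from : ∀ k {i j} → i < nV G → j < nV G → c (i + k) ≡ c (j + k) → i ≡ j
    distinct-from zero {i} {j} p q r =
      distinct p q (trans (cong c (sym (ℕₚ.+-identityʳ i))) (trans r (cong c (ℕₚ.+-identityʳ j))))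
    distinct-from (suc k) {i} {j} p q r with ℕₚ.m≤n⇒m<n∨m≡n p | ℕₚ.m≤n⇒m<n∨m≡n q
    ... | inj₁ p' | inj₁ q' = ℕₚ.suc-injective (distinct-from k p' q'
            (trans (cong c (sym (ℕₚ.+-suc i k))) (trans r (cong c (ℕₚ.+-suc j k)))))
    ... | inj₂ p' | inj₂ q' = ℕₚ.suc-injective (trans p' (sym q'))
    ... | inj₁ p' | inj₂ q' = contradiction (distinct-from k p' (≤-trans (s≤s z≤n) p)
            (trans (cong c (sym (ℕₚ.+-suc i k))) (trans r (wrap k q')))) λ ()
    ... | inj₂ p' | inj₁ q' = contradiction (distinct-from k q' (≤-trans (s≤s z≤n) p)
            (trans (cong c (sym (ℕₚ.+-suc j k))) (trans (sym r) (wrap k p')))) λ ()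

  rotate : ℕ → HamiltonCycle G
  rotate k = record
    { c = λ i → c (i + k)
    ; step = λ i → step (i + k)
    ; period = λ i → trans (cong c (trans (ℕₚ.+-assoc i (nV G) k) (trans (cong (i +_) (ℕₚ.+-comm (nV G) k)) (sym (ℕₚ.+-assoc i k (nV G)))))) (period (i + k))
    ; covers = covers-from k
    ; distinct = distinct-from k }

  rotate-to : ∀ v → ∃ λ k → k < nV G × HamiltonCycle.c (rotate k) 0 ≡ v
  rotate-to v = covers v

  -- Without `u` the Hamilton cycle is still a path through all other vertices.
  connAv-single : ∀ {u w} → u ≢ w → ConnAv G ⁅ u ⁆ w
  connAv-single {u} {w} u≢w y Sy with rotate-to u
  ... | k , _ , refl = go (covers-from k y) (covers-from k w)
    where
    off : ∀ {i} → 1 ≤ i → i < nV G → ⁅ c k ⁆ (c (i + k)) ≡ false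
    off {suc i} p q = ==ᶠ⇐≢ λ r → contradiction (distinct-from k q (≤-trans (s≤s z≤n) q) r) λ ()
    go : (∃ λ i → i < nV G × c (i + k) ≡ y) → (∃ λ i → i < nV G × c (i + k) ≡ w) → Star (AdjAv G ⁅ c k ⁆) y w
    go (zero , _ , refl) _ = contradiction refl (==ᶠ⇒≢ Sy)
    go _ (zero , _ , refl) = contradiction refl u≢w
    go (suc i , p , refl) (suc j , q , refl) with ℕₚ.≤-total i j
    ... | inj₁ le = walk-up {G} {⁅ c k ⁆} (λ t → c (t + k)) (suc j) (s≤s le)
                      (λ t a b → off (≤-trans (s≤s z≤n) a) (ℕₚ.≤-<-trans b q)) (λ t _ _ → step (t + k))
    ... | inj₂ le = walk-down {G} {⁅ c k ⁆} (λ t → c (t + k)) (suc i) (s≤s le)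
                      (λ t a b → off (≤-trans (s≤s z≤n) a) (ℕₚ.≤-<-trans b p)) (λ t _ _ → step (t + k))

  -- The chord starts at c (1 + k), whose neighbours on the cycle have the offsets l = 0 and l = 2.
  ChordAt : ℕ → Set
  ChordAt k = ∃ λ l → l < nV G × 3 ≤ l × Adj G (c (1 + k)) (c (l + k))

  chordAt? : ∀ k → Dec (ChordAt k)
  chordAt? k = anyUpTo? (λ l → (3 ≤? l) ×-dec Adj? G (c (1 + k)) (c (l + k))) (nV G)

module Structure (G : Hypergraph) (conn : Connected G) (0<Δ : 0 < Δ G) (¬col : ¬ DPColorable G (Δ G)) where

  open Critical G conn 0<Δ ¬col
  open HamiltonCycle

  private
    V : Set
    V = Fin (nV G)

  neighbour : ∀ v → ∃ λ u → Adj G v u × u ≢ v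
  neighbour v with count-pos (λ e → inc G e v) (subst (0 <_) (sym (regular v)) 0<Δ)
  ... | e , v∈e with other G e v
  ...   | u , u∈e , u≢v = u , (e , v∈e , u∈e) , u≢v

  -- A longest path P, cut after the last neighbour P j of its endpoint P 0, is a cycle. If it missed a
  -- vertex, some consecutive pair on it would contradict closed-neighbour.
  module _ {k} (P : Path {G} k) where

    open Path P renaming (step to pstep; distinct to pdistinct)

    module _ {j} (j≤k : j ≤ k) (last : Adj G (at 0) (at j)) (0<j : 0 < j)
             (closed₀ : ∀ y → Adj G (at 0) y → ∃ λ i → i < suc j × at i ≡ y) where

      private
        onC? : ∀ v → Dec (∃ λ i → i < suc j × at i ≡ v)
        onC? v = on? {G} at j v

        Open : ℕ → Set
        Open i = ∃ λ x → Adj G (at i) x × ¬ (∃ λ l → l < suc j × at l ≡ x)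

        open? : Decidable Open
        open? i = any? λ x → Adj? G (at i) x ×-dec ¬? (onC? x)

        missed⇒⊥ : ∀ i → suc i ≤ j → ¬ Open i → Open (suc i) → ⊥
        missed⇒⊥ i i<j shut (x , (g , wg , xg) , off) with pstep i (≤-trans i<j j≤k)
        ... | e , ue , we = closed-neighbour {S = S} u≢w ue we wg xg x≢u Su Sx Sw closed con conu
          where
          u w : V
          u = at i
          w = at (suc i)
          u≢w : u ≢ w
          u≢w q = contradiction (pdistinct (≤-trans (ℕₚ.n≤1+n i) (≤-trans i<j j≤k)) (≤-trans i<j j≤k) q) (ℕₚ.<⇒≢ ≤-refl)
          -- The vertices off the cycle are coloured together with `u`; what stays uncoloured is the
          -- cycle without `u`, a path.
          S : V → Bool
          S v = not (does (onC? v)) ∨ (v ==ᶠ u)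
          S-off : ∀ {v} → ¬ (∃ λ l → l < suc j × at l ≡ v) → S v ≡ true
          S-off {v} off = cong (λ b → not b ∨ (v ==ᶠ u)) (dec-false (onC? v) off)
          S-on : ∀ {v} → S v ≡ true → v ≢ u → ¬ (∃ λ l → l < suc j × at l ≡ v)
          S-on {v} Sv v≢u on with ∨-split {not (does (onC? v))} Sv
          ... | inj₁ q = true≢false (dec-true (onC? v) on) (not-true q)
          ... | inj₂ q = v≢u (==ᶠ⇒≡ q)
          S-false⁻ : ∀ {v} → S v ≡ false → (∃ λ l → l < suc j × at l ≡ v) × v ≢ u
          S-false⁻ {v} Sv with onC? v
          ... | yes on = on , ==ᶠ⇒≢ Sv
          S-false : ∀ l → l ≤ j → l ≢ i → S (at l) ≡ false
          S-false l l≤j l≢i = not-false λ q → S-on q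
            (λ r → l≢i (pdistinct (≤-trans l≤j j≤k) (≤-trans (ℕₚ.n≤1+n i) (≤-trans i<j j≤k)) r)) (l , s≤s l≤j , refl)
          x≢u : x ≢ u
          x≢u refl = off (i , s≤s (≤-trans (ℕₚ.n≤1+n i) i<j) , refl)
          Su : S u ≡ true
          Su with not (does (onC? u))
          ... | true = refl
          ... | false = ==ᶠ⇐≡ {a = u} refl
          Sx : S x ≡ true
          Sx = S-off off
          Sw : S w ≡ false
          Sw = S-false (suc i) i<j (λ q → ℕₚ.<⇒≢ ≤-refl (sym q))
          closed : ∀ f v → inc G f u ≡ true → inc G f v ≡ true → S v ≡ true → v ≡ u
          closed f v uf vf Sv = decidable-stable (v ≟ u) λ q → shut (v , (f , uf , vf) , S-on Sv q)
          con : ConnAv G S w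
          con y Sy with S-false⁻ Sy
          ... | (l , l<j , refl) , y≢u with ℕₚ.<-cmp l i
          ...   | tri≈ _ refl _ = contradiction refl y≢u
          ...   | tri> _ _ i<l = walk-down {G} {S} at l i<l
                    (λ t a b → S-false t (≤-trans b (s≤s⁻¹ l<j)) (λ q → ℕₚ.<⇒≢ a (sym q)))
                    (λ t _ b → pstep t (≤-trans b (≤-trans (s≤s⁻¹ l<j) j≤k)))
          -- Below the gap at `u` the way leads down to `at 0`, over the closing edge to `at j`, and
          -- down to `w`.
          ...   | tri< l<i _ _ = walk-down {G} {S} at l z≤n
                    (λ t _ b → S-false t (≤-trans b (s≤s⁻¹ l<j)) (ℕₚ.<⇒≢ (ℕₚ.≤-<-trans b l<i)))
                    (λ t _ b → pstep t (≤-trans b (≤-trans (s≤s⁻¹ l<j) j≤k)))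
                  ◅◅ ((S-false 0 z≤n (ℕₚ.<⇒≢ (ℕₚ.≤-<-trans z≤n l<i)) , S-false j ≤-refl (λ q → ℕₚ.<⇒≢ i<j (sym q)) , last)
                  ◅ walk-down {G} {S} at j i<j (λ t a b → S-false t b (λ q → ℕₚ.<⇒≢ a (sym q))) (λ t _ b → pstep t (≤-trans b j≤k)))
          weaken : ∀ {v} → S v ≡ false → ⁅ u ⁆ v ≡ false
          weaken Sv = ==ᶠ⇐≢ (proj₂ (S-false⁻ Sv))
          -- No vertex off the cycle is adjacent to `u`, so a walk from there reaches the cycle at
          -- another vertex, from which `con` continues.
          conu : ConnAv G ⁅ u ⁆ w
          conu y Sy = go (connAv-∅ {G} conn w y refl) (==ᶠ⇒≢ Sy)
            where
            go : ∀ {y} → Star (AdjAv G ∅) y w → y ≢ u → Star (AdjAv G ⁅ u ⁆) y w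
            go ε _ = ε
            go {y} (_◅_ {_} {z} (_ , _ , yz) r) y≢u with onC? y
            ... | yes (l , l<j , refl) = Star.map (λ (a , b , ab) → weaken a , weaken b , ab)
                    (con y (S-false l (s≤s⁻¹ l<j) λ { refl → y≢u refl }))
            ... | no yoff = (==ᶠ⇐≢ y≢u , ==ᶠ⇐≢ z≢u , yz) ◅ go r z≢u
              where
              z≢u : z ≢ u
              z≢u refl = shut (y , Adj-sym G yz , yoff)

      cycle-covers : ∀ v → ∃ λ i → i < suc j × at i ≡ v
      cycle-covers v with onC? v
      ... | yes on = on
      ... | no off with crossing G (λ v → does (onC? v)) (connAv-∅ {G} conn (at 0) v refl) (dec-false (onC? v) off)
                          (dec-true (onC? (at 0)) (0 , s≤s z≤n , refl))
      ...   | u , r , _ , u∉C , r∈C , ur with does-sound (onC? r) r∈C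
      ...     | l , l<j , refl with first-change open? shut₀ l (u , Adj-sym G ur , λ on → true≢false (dec-true (onC? u) on) u∉C)
        where
        shut₀ : ¬ Open 0
        shut₀ (x , a , off) = off (closed₀ x a)
      ...       | i , i<l , shut , opn = ⊥-elim (missed⇒⊥ i (≤-trans i<l (s≤s⁻¹ l<j)) shut opn)

      private
        next : ℕ → ℕ
        next i with i ℕₚ.≟ j
        ... | yes _ = 0
        ... | no _ = suc i

        pos : ℕ → ℕ
        pos zero = 0
        pos (suc i) = next (pos i)

        next-≤ : ∀ {i} → i ≤ j → next i ≤ j
        next-≤ {i} le with i ℕₚ.≟ j
        ... | yes _ = z≤n
        ... | no ne = ℕₚ.≤∧≢⇒< le ne

        pos-≤ : ∀ i → pos i ≤ j
        pos-≤ zero = z≤n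
        pos-≤ (suc i) = next-≤ (pos-≤ i)

        next-adj : ∀ {i} → i ≤ j → Adj G (at i) (at (next i))
        next-adj {i} le with i ℕₚ.≟ j
        ... | yes refl = Adj-sym G last
        ... | no ne = pstep i (≤-trans (ℕₚ.≤∧≢⇒< le ne) j≤k)

        pos-small : ∀ i → i ≤ j → pos i ≡ i
        pos-small zero _ = refl
        pos-small (suc i) le rewrite pos-small i (≤-trans (ℕₚ.n≤1+n i) le) with i ℕₚ.≟ j
        ... | yes refl = contradiction le (ℕₚ.<-irrefl refl)
        ... | no _ = refl

        pos-period : ∀ i → pos (i + suc j) ≡ pos i
        pos-period zero rewrite pos-small j ≤-refl with j ℕₚ.≟ j
        ... | yes _ = refl
        ... | no ne = contradiction refl ne
        pos-period (suc i) = cong next (pos-period i)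

        length≡ : suc j ≡ nV G
        length≡ = ≤-antisym
          (injective⇒≤ {f = λ (i : Fin (suc j)) → at (toℕ i)} λ {a} {b} q → toℕ-injective
            (pdistinct (≤-trans (s≤s⁻¹ (toℕ<n a)) j≤k) (≤-trans (s≤s⁻¹ (toℕ<n b)) j≤k) q))
          (injective⇒≤ {f = index} λ {a} {b} q → trans (sym (at-index a)) (trans (cong (λ i → at (toℕ i)) q) (at-index b)))
          where
          index : V → Fin (suc j)
          index v = fromℕ< (proj₁ (proj₂ (cycle-covers v)))
          at-index : ∀ v → at (toℕ (index v)) ≡ v
          at-index v = trans (cong at (toℕ-fromℕ< _)) (proj₂ (proj₂ (cycle-covers v)))

      close : HamiltonCycle G
      close = record
        { c = λ i → at (pos i)
        ; step = λ i → next-adj (pos-≤ i)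
        ; period = λ i → cong at (trans (cong (λ t → pos (i + t)) (sym length≡)) (pos-period i))
        ; covers = λ v → let i , lt , q = cycle-covers v in
            i , subst (i <_) length≡ lt , trans (cong at (pos-small i (s≤s⁻¹ lt))) q
        ; distinct = λ {a} {b} p q r → let p' = s≤s⁻¹ (subst (a <_) (sym length≡) p)
                                           q' = s≤s⁻¹ (subst (b <_) (sym length≡) q) in
            pdistinct (≤-trans p' j≤k) (≤-trans q' j≤k)
              (trans (cong at (sym (pos-small a p'))) (trans r (cong at (pos-small b q')))) }

  hamiltonian : V → HamiltonCycle G
  hamiltonian v with maximal-path (nV G) 0 ≤-refl (record { at = λ _ → v ; distinct = λ { z≤n z≤n _ → refl } ; step = λ _ () })
  ... | k , P , end-closed with neighbour (Path.at P 0)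
  ...   | u , a , u≢ with end-closed u a
  -- The largest index is taken so that every neighbour of the endpoint lies on the cycle.
  ...     | i , i<k , refl with largest (λ i → Adj? G (Path.at P 0) (Path.at P i)) k (s≤s⁻¹ i<k) a
  ...       | j , j≤k , a' , mx = close P j≤k a' (0<j i u≢ (mx i (s≤s⁻¹ i<k) a)) λ y b →
                let l , l<k , q = end-closed y b in
                l , s≤s (mx l (s≤s⁻¹ l<k) (subst (Adj G (Path.at P 0)) (sym q) b)) , q
    where
    0<j : ∀ i {j} → Path.at P i ≢ Path.at P 0 → i ≤ j → 0 < j
    0<j zero ne _ = contradiction refl ne
    0<j (suc i) _ le = ≤-trans (s≤s z≤n) le

-- Classification of the uncolorable hypergraphs

Fin-singleton : ∀ {m} (e : Fin m) → (∀ f → f ≡ e) → m ≡ 1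
Fin-singleton {suc zero} e h = refl
Fin-singleton {suc (suc m)} e h with trans (h fzero) (sym (h (fsuc fzero)))
... | ()

module Classification (G : Hypergraph) (conn : Connected G) (0<Δ : 0 < Δ G) (¬col : ¬ DPColorable G (Δ G))
                      (H : HamiltonCycle G) (3≤n : 3 ≤ nV G) where

  open Critical G conn 0<Δ ¬col
  open Structure G conn 0<Δ ¬col using (neighbour)
  open HamiltonCycle H

  private
    V : Set
    V = Fin (nV G)

    c-distinct : ∀ k {i j} → i < nV G → j < nV G → c (i + k) ≡ c (j + k) → i ≡ j
    c-distinct k = HamiltonCycle.distinct (rotate H k)

    c-covers : ∀ k v → ∃ λ i → i < nV G × c (i + k) ≡ v
    c-covers k = HamiltonCycle.covers (rotate H k)

    Arc : ℕ → ℕ → V → Set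
    Arc k i v = ∃ λ t → t < i × c (suc t + k) ≡ v

    arc? : ∀ k i v → Dec (Arc k i v)
    arc? k i v = anyUpTo? (λ t → c (suc t + k) ≟ v) i

  -- The arc of the cycle from c (1 + k) to a vertex of e can be recoloured after z = c k, leaving x untouched.
  hyperedge-arc : ∀ {e f} k {i l} → e ≢ f → i < nV G → l < nV G → suc i ≤ l → 0 < i →
    inc G e (c k) ≡ true → inc G e (c (i + k)) ≡ true → inc G e (c (l + k)) ≡ true →
    inc G f (c k) ≡ true → inc G f (c (suc k)) ≡ true → ⊥
  hyperedge-arc {e} {f} k {i} {l} e≢f i<n l<n i<l 0<i ze ae xe zf rf =
    recolor-hyperedge {S} e≢f ae ze xe (λ q → ℕₚ.<⇒≢ (≤-trans 0<i (≤-trans (ℕₚ.n≤1+n i) i<l)) (sym (c-distinct k l<n 0<n q))) zf rf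
      (outside λ { (t , t<i , q) → contradiction (c-distinct k (ℕₚ.≤-<-trans t<i i<n) 0<n q) λ () })
      (outside λ { (t , t<i , q) → ℕₚ.<⇒≢ (ℕₚ.≤-<-trans t<i i<l) (c-distinct k (ℕₚ.≤-<-trans t<i i<n) l<n q) })
      (inside 0<i ≤-refl) (inside {1} ≤-refl 0<i) con
    where
    0<n : 0 < nV G
    0<n = ≤-trans (s≤s z≤n) 3≤n
    S : V → Bool
    S v = not (does (arc? k i v))
    outside : ∀ {v} → ¬ Arc k i v → S v ≡ true
    outside {v} na = cong not (dec-false (arc? k i v) na)
    inside : ∀ {t} → 0 < t → t ≤ i → S (c (t + k)) ≡ false
    inside {suc t} _ le = cong not (dec-true (arc? k i _) (t , le , refl))
    con : ConnAv G S (c (i + k))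
    con y Sy with arc? k i y
    ... | yes (t , t<i , refl) = walk-up {G} {S} (λ t → c (t + k)) i t<i
            (λ s a b → inside (≤-trans (s≤s z≤n) a) b) (λ s _ _ → step (s + k))

  offset-positive : ∀ k {i} → c (i + k) ≢ c k → 0 < i
  offset-positive k {zero} ne = contradiction refl ne
  offset-positive k {suc i} _ = s≤s z≤n

  -- If the cycle leaves `c k` by an edge `f` other than `e`, take two further vertices of `e`: the
  -- one met first along the cycle ends the arc of `hyperedge-arc`, the other keeps its colour.
  hyperedge-spreads : ∀ {e} → 3 ≤ count (inc G e) → ∀ k → inc G e (c k) ≡ true → inc G e (c (suc k)) ≡ true
  hyperedge-spreads {e} big k ke with step k
  ... | f , kf , k'f with e ≟ f
  ...   | yes refl = k'f
  ...   | no e≢f with other G e (c k)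
  ...     | x , xe , x≢ with count-third (inc G e) (c k) x big
  ...       | y , ye , y≢ , y≢x with c-covers k x | c-covers k y
  ...         | i , i<n , refl | l , l<n , refl with ℕₚ.<-cmp i l
  ...           | tri≈ _ refl _ = contradiction refl y≢x
  ...           | tri< i<l _ _ = ⊥-elim (hyperedge-arc k e≢f i<n l<n i<l (offset-positive k x≢) ke xe ye kf k'f)
  ...           | tri> _ _ l<i = ⊥-elim (hyperedge-arc k e≢f l<n i<n l<i (offset-positive k y≢) ke ye xe kf k'f)

  hyperedge-spans : ∀ {e} → 3 ≤ count (inc G e) → ∀ v → inc G e v ≡ true
  hyperedge-spans {e} big v with count-pos (inc G e) (≤-trans (s≤s z≤n) big)
  ... | u , ue with covers u
  ...   | k , _ , refl with c-covers k v
  ...     | i , _ , refl = spread i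
    where
    spread : ∀ i → inc G e (c (i + k)) ≡ true
    spread zero = ue
    spread (suc i) = hyperedge-spreads big (i + k) (spread i)

  -- A second edge `f` would share two vertices `y` and `z` with the spanning edge `e`. Leaving only
  -- `y` uncoloured, `recolor-hyperedge` applies with `y` as the common vertex off `S` of both
  -- edges.
  hyperedge⇒single : ∀ {e} → 3 ≤ count (inc G e) → IsSingleEdge G
  hyperedge⇒single {e} big = Fin-singleton e only , λ f v → subst (λ g → inc G g v ≡ true) (sym (only f)) (hyperedge-spans big v)
    where
    only : ∀ f → f ≡ e
    only f = decidable-stable (f ≟ e) absurd
      where
      absurd : ¬ f ≢ e
      absurd f≢e with count-pos (inc G f) (≤-trans (s≤s z≤n) (size G f))
      ... | y , yf with other G f y
      ...   | z , zf , z≢y with count-third (inc G e) y z big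
      ...     | x , xe , x≢y , x≢z = recolor-hyperedge {S} (λ q → f≢e (sym q)) (hyperedge-spans big y) (hyperedge-spans big z) xe x≢z zf yf
                  (cong not (==ᶠ⇐≢ z≢y)) (cong not (==ᶠ⇐≢ x≢y)) Sy Sy (λ u Su → stay u Su)
        where
        S : V → Bool
        S v = not (v ==ᶠ y)
        Sy : S y ≡ false
        Sy = cong not (==ᶠ⇐≡ {a = y} refl)
        stay : ∀ u → S u ≡ false → Star (AdjAv G S) u y
        stay u Su with u ≟ y
        ... | yes refl = ε

  -- Ordinary hypergraphs: chords and multiplicities

  module _ (ord : Ordinary G) where

    triangle : ∀ {a b d} → a ≢ b → a ≢ d → b ≢ d → Adj G a d →
      (∀ y → y ≢ b → y ≢ d → Star (AdjAv G (λ v → (v ==ᶠ b) ∨ (v ==ᶠ d))) y a) → mult G a b ≤ mult G b d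
    triangle {a} {b} {d} a≢b a≢d b≢d ad con = mult-triangle ord {S = S} a≢b a≢d b≢d
      (cong (_∨ (b ==ᶠ d)) (==ᶠ⇐≡ {a = b} refl))
      (trans (cong ((d ==ᶠ b) ∨_) (==ᶠ⇐≡ {a = d} refl)) (∨-zeroʳ (d ==ᶠ b)))
      (cong₂ _∨_ (==ᶠ⇐≢ a≢b) (==ᶠ⇐≢ a≢d)) members
      (λ y Sy → con y (==ᶠ⇒≢ (proj₁ (∨-false Sy))) (==ᶠ⇒≢ (proj₂ (∨-false {y ==ᶠ b} Sy))))
      (connAv-single H a≢b) (connAv-single H a≢d) ad
      where
      S : V → Bool
      S v = (v ==ᶠ b) ∨ (v ==ᶠ d)
      members : ∀ v → S v ≡ true → v ≡ b ⊎ v ≡ d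
      members v Sv with ∨-split {v ==ᶠ b} Sv
      ... | inj₁ q = inj₁ (==ᶠ⇒≡ q)
      ... | inj₂ q = inj₂ (==ᶠ⇒≡ q)

    avoid : ∀ {b d y : V} → y ≢ b → y ≢ d → (y ==ᶠ b) ∨ (y ==ᶠ d) ≡ false
    avoid p q = cong₂ _∨_ (==ᶠ⇐≢ p) (==ᶠ⇐≢ q)

    c-≢ : ∀ k {i j} → i < nV G → j < nV G → i ≢ j → c (i + k) ≢ c (j + k)
    c-≢ k p q ne r = ne (c-distinct k p q r)

    triangle-adj : ∀ {a b d} → a ≢ b → a ≢ d → b ≢ d → Adj G a b → Adj G a d →
      (∀ y → y ≢ b → y ≢ d → Star (AdjAv G (λ v → (v ==ᶠ b) ∨ (v ==ᶠ d))) y a) → Adj G b d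
    triangle-adj a≢b a≢d b≢d ab ad con = mult>0⇒adj {G} (≤-trans (adj⇒mult>0 {G} ab) (triangle a≢b a≢d b≢d ad con))

    -- Without `c k` and `c (2 + k)` the cycle falls apart into `c (1 + k)` and a path, and the
    -- chord joins the two; hence `triangle-adj` applies at `c (1 + k)`.
    chord-skip : ∀ k → ChordAt H k → Adj G (c k) (c (2 + k))
    chord-skip k (l , l<n , 3≤l , al) = triangle-adj (c-≢ k 1<n 0<n λ ()) (c-≢ k 1<n 2<n λ ()) (c-≢ k 0<n 2<n λ ())
      (Adj-sym G (step k)) (step (suc k)) con
      where
      2<n : 2 < nV G
      2<n = 3≤n
      1<n : 1 < nV G
      1<n = ≤-trans (ℕₚ.n≤1+n _) 2<n
      0<n : 0 < nV G
      0<n = ≤-trans (ℕₚ.n≤1+n _) 1<n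
      S : V → Bool
      S v = (v ==ᶠ c k) ∨ (v ==ᶠ c (2 + k))
      free : ∀ {i} → i < nV G → 3 ≤ i → S (c (i + k)) ≡ false
      free i<n 3≤i = avoid (c-≢ k i<n 0<n λ { refl → contradiction 3≤i λ () }) (c-≢ k i<n 2<n λ { refl → ℕₚ.<-irrefl refl 3≤i })
      con : ∀ y → y ≢ c k → y ≢ c (2 + k) → Star (AdjAv G S) y (c (1 + k))
      con y y≢0 y≢2 with c-covers k y
      ... | 0 , _ , refl = contradiction refl y≢0
      ... | 1 , _ , refl = ε
      ... | 2 , _ , refl = contradiction refl y≢2
      ... | i@(suc (suc (suc _))) , i<n , refl = toChord ◅◅ ((free l<n 3≤l , avoid (c-≢ k 1<n 0<n λ ()) (c-≢ k 1<n 2<n λ ()) , Adj-sym G al) ◅ ε)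
        where
        3≤i : 3 ≤ i
        3≤i = s≤s (s≤s (s≤s z≤n))
        toChord : Star (AdjAv G S) (c (i + k)) (c (l + k))
        toChord with ℕₚ.≤-total i l
        ... | inj₁ le = walk-up {G} {S} (λ t → c (t + k)) l le (λ t a b → free (ℕₚ.≤-<-trans b l<n) (≤-trans 3≤i a)) (λ t _ _ → step (t + k))
        ... | inj₂ le = walk-down {G} {S} (λ t → c (t + k)) i le (λ t a b → free (ℕₚ.≤-<-trans b i<n) (≤-trans 3≤l a)) (λ t _ _ → step (t + k))

    around : ∀ k {l} → suc l ≡ nV G → c (l + suc k) ≡ c k
    around k {l} q = trans (cong c (trans (ℕₚ.+-suc l k) (trans (cong (_+ k) q) (ℕₚ.+-comm (nV G) k)))) (period k)

    -- The adjacency of `c k` and `c (2 + k)` is itself a chord at `c (2 + k)`, seen from `suc k`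
    -- with offset `nV G - 1`. This offset is at least 3 because a chord forces four vertices.
    chord-next : ∀ k → ChordAt H k → ChordAt H (suc k)
    chord-next k ch@(l , l<n , 3≤l , _) with predecessor (≤-trans (s≤s z≤n) 3≤n)
    ... | l' , q = l' , ≤-reflexive q , s≤s⁻¹ (≤-trans (ℕₚ.≤-<-trans 3≤l l<n) (≤-reflexive (sym q))) ,
          subst (Adj G (c (1 + suc k))) (sym (around k q)) (Adj-sym G (chord-skip k ch))

    chord-later : ∀ j k → ChordAt H k → ChordAt H (j + k)
    chord-later zero k ch = ch
    chord-later (suc j) k ch = chord-next (j + k) (chord-later j k ch)

    -- Chords propagate forwards to index `nV G`, which the period identifies with 0.
    chord-all : ∀ k → k ≤ nV G → ChordAt H k → ChordAt H 0
    chord-all k le ch with chord-later (nV G ∸ k) k ch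
    ... | l , l<n , 3≤l , al = l , l<n , 3≤l , subst₂ (Adj G) (back 1) (back l) al
      where
      back : ∀ i → c (i + (nV G ∸ k + k)) ≡ c (i + 0)
      back i = trans (cong (λ t → c (i + t)) (ℕₚ.m∸n+n≡m le)) (trans (period i) (cong c (sym (ℕₚ.+-identityʳ i))))

    module _ (ch : ChordAt H 0) where

      skip : ∀ k → Adj G (c k) (c (2 + k))
      skip k = chord-skip k (subst (ChordAt H) (ℕₚ.+-identityʳ k) (chord-later k 0 ch))

      -- Induction on the distance, with `triangle-adj` at `c (suc i + k)`. Removing `c k` and
      -- `c (2 + i + k)` leaves at most two arcs, and the skip over the latter vertex joins them.
      adj-from : ∀ k i → suc i < nV G → Adj G (c k) (c (suc i + k))
      adj-from k zero _ = step k
      adj-from k (suc i) i<n = triangle-adj (c-≢ k i'<n 0<n λ ()) (c-≢ k i'<n i<n (ℕₚ.<⇒≢ ≤-refl)) (c-≢ k 0<n i<n λ ())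
        (Adj-sym G (adj-from k i i'<n)) (step (suc i + k)) con
        where
        i'<n : suc i < nV G
        i'<n = ≤-trans (ℕₚ.n≤1+n _) i<n
        0<n : 0 < nV G
        0<n = ≤-trans (s≤s z≤n) i<n
        S : V → Bool
        S v = (v ==ᶠ c k) ∨ (v ==ᶠ c (2 + i + k))
        free : ∀ {t} → t < nV G → 0 < t → t ≢ 2 + i → S (c (t + k)) ≡ false
        free t<n 0<t ne = avoid (c-≢ k t<n 0<n λ { refl → contradiction 0<t λ () }) (c-≢ k t<n i<n ne)
        con : ∀ y → y ≢ c k → y ≢ c (2 + i + k) → Star (AdjAv G S) y (c (suc i + k))
        con y y≢0 y≢i with c-covers k y
        ... | zero , _ , refl = contradiction refl y≢0
        ... | suc t , t<n , refl with ℕₚ.<-cmp (suc t) (2 + i)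
        ...   | tri≈ _ refl _ = contradiction refl y≢i
        ...   | tri< lt _ _ = walk-up {G} {S} (λ t → c (t + k)) (suc i) (s≤s⁻¹ lt)
                  (λ s a b → free (ℕₚ.≤-<-trans b i'<n) (≤-trans (s≤s z≤n) a) (ℕₚ.<⇒≢ (s≤s b))) (λ s _ _ → step (s + k))
        ...   | tri> _ _ gt = walk-down {G} {S} (λ t → c (t + k)) (suc t) gt
                  (λ s a b → free (ℕₚ.≤-<-trans b t<n) (≤-trans (s≤s z≤n) a) (λ q → ℕₚ.<⇒≢ a (sym q))) (λ s _ _ → step (s + k))
                ◅◅ ((free (ℕₚ.≤-<-trans gt t<n) (s≤s z≤n) (λ q → ℕₚ.<⇒≢ ≤-refl (sym q)) , free i'<n (s≤s z≤n) (ℕₚ.<⇒≢ ≤-refl) ,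
                     Adj-sym G (skip (suc i + k))) ◅ ε)

      complete : ∀ {u v} → u ≢ v → Adj G u v
      complete {u} {v} u≢v with covers u
      ... | k , _ , refl with c-covers k v
      ...   | zero , _ , refl = contradiction refl u≢v
      ...   | suc i , lt , refl = adj-from k i lt

      mult-≤ : ∀ {a b d} → a ≢ b → a ≢ d → b ≢ d → mult G a b ≤ mult G b d
      mult-≤ {a} {b} {d} a≢b a≢d b≢d = triangle a≢b a≢d b≢d (complete a≢d) con
        where
        con : ∀ y → y ≢ b → y ≢ d → Star (AdjAv G (λ v → (v ==ᶠ b) ∨ (v ==ᶠ d))) y a
        con y p q with y ≟ a
        ... | yes refl = ε
        ... | no y≢a = (avoid p q , avoid a≢b a≢d , complete y≢a) ◅ ε

      mult-≤-share : ∀ {a b d} → a ≢ b → b ≢ d → mult G a b ≤ mult G b d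
      mult-≤-share {a} {b} {d} a≢b b≢d with a ≟ d
      ... | yes refl = ≤-reflexive (mult-sym {G} a b)
      ... | no a≢d = mult-≤ a≢b a≢d b≢d

      mult-≤-any : ∀ {u v x y} → u ≢ v → x ≢ y → mult G u v ≤ mult G x y
      mult-≤-any {u} {v} {x} {y} u≢v x≢y with v ≟ x
      ... | yes refl = mult-≤-share u≢v x≢y
      ... | no v≢x = ≤-trans (mult-≤-share u≢v v≢x) (mult-≤-share v≢x x≢y)

      isTK : IsTK G
      isTK = mult G (c 0) (c 1) , adj⇒mult>0 {G} (step 0) , ≤-trans (s≤s z≤n) 3≤n , ord ,
        λ u v u≢v → ≤-antisym (mult-≤-any u≢v 0≢1) (mult-≤-any 0≢1 u≢v)
        where
        0≢1 : c 0 ≢ c 1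
        0≢1 q = contradiction (distinct (≤-trans (s≤s z≤n) 3≤n) (≤-trans (s≤s (s≤s z≤n)) 3≤n) q) λ ()

    module _ (nch : ¬ ChordAt H 0) where

      only-neighbours : ∀ k → k ≤ nV G → ∀ {y} → y ≢ c (1 + k) → Adj G (c (1 + k)) y → y ≡ c k ⊎ y ≡ c (2 + k)
      only-neighbours k le {y} y≢ a with c-covers k y
      ... | 0 , _ , refl = inj₁ refl
      ... | 1 , _ , refl = contradiction refl y≢
      ... | 2 , _ , refl = inj₂ refl
      ... | i@(suc (suc (suc _))) , lt , refl = contradiction (chord-all k le (i , lt , s≤s (s≤s (s≤s z≤n)) , a)) nch

      t : ℕ → ℕ
      t k = mult G (c k) (c (1 + k))

      t>0 : ∀ k → 0 < t k
      t>0 k = adj⇒mult>0 {G} (step k)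

      c-step≢ : ∀ k → c k ≢ c (1 + k)
      c-step≢ k q = contradiction (c-distinct k (≤-trans (s≤s z≤n) 3≤n) (≤-trans (s≤s (s≤s z≤n)) 3≤n) q) λ ()

      c-skip≢ : ∀ k → c k ≢ c (2 + k)
      c-skip≢ k q = contradiction (c-distinct k (≤-trans (s≤s z≤n) 3≤n) 3≤n q) λ ()

      -- An edge at `c (1 + k)` has exactly one further end, a neighbour on the cycle, so missing
      -- `c k` amounts to containing `c (2 + k)`.
      degree-split : ∀ k → k ≤ nV G → Δ G ≡ t k + t (1 + k)
      degree-split k le = trans (sym (regular (c (1 + k)))) (trans (count-split (λ e → inc G e (c (1 + k))) (λ e → inc G e (c k)))
        (cong₂ _+_ (mult-sym {G} (c (1 + k)) (c k)) (count-cong other-end)))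
        where
        other-end : ∀ e → inc G e (c (1 + k)) ∧ not (inc G e (c k)) ≡ inc G e (c (1 + k)) ∧ inc G e (c (2 + k))
        other-end e with inc G e (c (1 + k)) in v∈e | inc G e (c k) in u∈e | inc G e (c (2 + k)) in w∈e
        ... | false | _ | _ = refl
        ... | true | false | true = refl
        ... | true | true | false = refl
        ... | true | true | true with count-2-exhaust (inc G e) (ord e) v∈e u∈e (λ q → c-step≢ k (sym q)) w∈e
        ...   | inj₁ q = contradiction (sym q) (c-step≢ (1 + k))
        ...   | inj₂ q = contradiction (sym q) (c-skip≢ k)
        other-end e | true | false | false with other G e (c (1 + k))
        ...   | y , y∈e , y≢ with only-neighbours k le y≢ (e , v∈e , y∈e)
        ...     | inj₁ refl = contradiction u∈e (true≢false y∈e)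
        ...     | inj₂ refl = contradiction w∈e (true≢false y∈e)

      -- Twice either multiplicity is at most `Δ G`, which is their sum. The hypothesis of
      -- `mult-double` holds because the other multiplicity is positive.
      t-const-step : ∀ k → k ≤ nV G → t k ≡ t (1 + k)
      t-const-step k le = ≤-antisym
        (ℕₚ.+-cancelˡ-≤ (t k) _ _ (subst (t k + t k ≤_) (degree-split k le)
          (mult-double (c-step≢ k) (connAv-single H (c-step≢ k)) (subst (t k <_) (sym (regular _)) lt₁))))
        (ℕₚ.+-cancelʳ-≤ (t (1 + k)) _ _ (subst (t (1 + k) + t (1 + k) ≤_) (degree-split k le)
          (mult-double (c-step≢ (1 + k)) (connAv-single H (c-step≢ (1 + k))) (subst (t (1 + k) <_) (sym (regular _)) lt₂))))
        where
        lt₁ : t k < Δ G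
        lt₁ = subst (t k <_) (sym (degree-split k le)) (ℕₚ.m<m+n (t k) (t>0 (1 + k)))
        lt₂ : t (1 + k) < Δ G
        lt₂ = subst (t (1 + k) <_) (sym (degree-split k le)) (ℕₚ.m<n+m (t (1 + k)) (t>0 k))

      t-const : ∀ k → k ≤ nV G → t k ≡ t 0
      t-const zero _ = refl
      t-const (suc k) le = trans (sym (t-const-step k (≤-trans (ℕₚ.n≤1+n k) le))) (t-const k (≤-trans (ℕₚ.n≤1+n k) le))

      σ : V → V
      σ a = c (toℕ a)

      σ-step : ∀ a b → suc (toℕ a) ≡ toℕ b → mult G (σ a) (σ b) ≡ t 0
      σ-step a b q = trans (cong (λ i → mult G (c (toℕ a)) (c i)) (sym q)) (t-const (toℕ a) (ℕₚ.<⇒≤ (toℕ<n a)))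

      σ-wrap : ∀ a b → toℕ a ≡ 0 → suc (toℕ b) ≡ nV G → mult G (σ b) (σ a) ≡ t 0
      σ-wrap a b p q = trans (cong (mult G (c (toℕ b))) (trans (cong c p) (trans (sym (period 0)) (cong c (sym q)))))
        (t-const (toℕ b) (ℕₚ.<⇒≤ (toℕ<n b)))

      cyclic : ∀ a b → CycAdj a b → mult G (σ a) (σ b) ≡ t 0
      cyclic a b (inj₁ q) = σ-step a b q
      cyclic a b (inj₂ (inj₁ q)) = trans (mult-sym {G} (σ a) (σ b)) (σ-step b a q)
      cyclic a b (inj₂ (inj₂ (inj₁ (p , q)))) = trans (mult-sym {G} (σ a) (σ b)) (σ-wrap a b p q)
      cyclic a b (inj₂ (inj₂ (inj₂ (p , q)))) = σ-wrap b a p q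

      σ-injective : ∀ {a b} → σ a ≡ σ b → a ≡ b
      σ-injective {a} {b} q = toℕ-injective (distinct (toℕ<n a) (toℕ<n b) q)

      adj⇒cyclic : ∀ a b → a ≢ b → Adj G (σ a) (σ b) → CycAdj a b
      adj⇒cyclic a b a≢b adj = go (toℕ a) refl
        where
        go : ∀ i → i ≡ toℕ a → CycAdj a b
        go (suc k) ia with only-neighbours k (≤-trans (ℕₚ.n≤1+n k) (ℕₚ.<⇒≤ k<n))
              (λ q → a≢b (sym (σ-injective (trans q (cong c ia))))) (subst (λ i → Adj G (c i) (σ b)) (sym ia) adj)
          where
          k<n : suc k < nV G
          k<n = subst (_< nV G) (sym ia) (toℕ<n a)
        ... | inj₁ q = inj₂ (inj₁ (trans (cong suc (distinct (toℕ<n b) (≤-trans (ℕₚ.n≤1+n _) (subst (_< nV G) (sym ia) (toℕ<n a))) q)) ia))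
        ... | inj₂ q with ℕₚ.m≤n⇒m<n∨m≡n (subst (_< nV G) (sym ia) (toℕ<n a))
        ...   | inj₁ lt = inj₁ (trans (cong suc (sym ia)) (sym (distinct (toℕ<n b) lt q)))
        ...   | inj₂ r = inj₂ (inj₂ (inj₂ (distinct (toℕ<n b) (≤-trans (s≤s z≤n) 3≤n) (trans q (trans (cong c r) (period 0))) , trans (cong suc (sym ia)) r)))
        -- `only-neighbours` speaks of successor indices, so the vertex `c 0` is viewed as
        -- `c (nV G)`.
        go zero ia with predecessor (≤-trans (s≤s z≤n) 3≤n)
        ... | l , r with only-neighbours l (≤-trans (ℕₚ.n≤1+n l) (≤-reflexive r))
              (λ q → a≢b (sym (σ-injective (trans q (trans c-back (cong c ia))))))
              (subst (λ v → Adj G v (σ b)) (sym (trans c-back (cong c ia))) adj)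
          where
          c-back : c (1 + l) ≡ c 0
          c-back = trans (cong c r) (period 0)
        ...   | inj₁ q = inj₂ (inj₂ (inj₁ (sym ia , trans (cong suc (distinct (toℕ<n b) (≤-reflexive r) q)) r)))
        ...   | inj₂ q = inj₁ (trans (cong suc (sym ia)) (sym (distinct (toℕ<n b) (≤-trans (s≤s (s≤s z≤n)) 3≤n)
                  (trans q (trans (cong (λ i → c (suc i)) r) (period 1))))))

      isTC : IsTC G
      isTC = t 0 , t>0 0 , 3≤n , ord , σ , σ-injective , λ a b a≢b → cyclic a b , λ nadj →
        ℕₚ.n≤0⇒n≡0 (ℕₚ.≮⇒≥ λ lt → nadj (adj⇒cyclic a b a≢b (mult>0⇒adj {G} lt)))

  brick : DPHyperbrick G
  brick with all? (λ e → count (inc G e) ℕₚ.≟ 2)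
  -- On three vertices no offset reaches 3, so triangles fall under the chordless case.
  ... | yes ord with chordAt? H 0
  ...   | yes ch = inj₁ (isTK ord ch)
  ...   | no nch = inj₂ (inj₁ (isTC ord nch))
  brick | no ¬ord with ¬∀⟶∃¬ _ (λ e → count (inc G e) ≡ 2) (λ e → count (inc G e) ℕₚ.≟ 2) ¬ord
  ...   | e , ne = inj₂ (inj₂ (hyperedge⇒single (ℕₚ.≤∧≢⇒< (size G e) (λ q → ne (sym q)))))

-- Uncolorable covers of the bricks

least : (P : Fin n → Bool) → 0 < count P → ∃ λ x → P x ≡ true × (∀ y → P y ≡ true → toℕ x ≤ toℕ y)
least {suc n} P h with P fzero in P0
... | true = fzero , P0 , λ _ _ → z≤n
... | false with least (λ x → P (fsuc x)) h
...   | x , Px , mn = fsuc x , Px , λ { fzero Py → contradiction P0 (true≢false Py) ; (fsuc y) Py → s≤s (mn y Py) }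

-- Counts the elements of `P` before `x`; it numbers the edges on a given pair of vertices from 0.
rank : (Fin n → Bool) → Fin n → ℕ
rank P fzero = 0
rank P (fsuc x) = (if P fzero then 1 else 0) + rank (λ y → P (fsuc y)) x

rank-onto : (P : Fin n → Bool) (k : ℕ) → k < count P → ∃ λ x → P x ≡ true × rank P x ≡ k
rank-onto {suc n} P k h with P fzero in P0
rank-onto {suc n} P zero h | true = fzero , P0 , refl
rank-onto {suc n} P (suc k) h | true with rank-onto (λ x → P (fsuc x)) k (s≤s⁻¹ h)
... | x , Px , q = fsuc x , Px , trans (cong (λ b → (if b then 1 else 0) + rank (λ y → P (fsuc y)) x) P0) (cong suc q)
rank-onto {suc n} P k h | false with rank-onto (λ x → P (fsuc x)) k h
... | x , Px , q = fsuc x , Px , trans (cong (λ b → (if b then 1 else 0) + rank (λ y → P (fsuc y)) x) P0) q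

count-fibres : ∀ k (P : Fin m → Bool) (A : Fin n → Bool) (l : Fin m → Fin n) t → count A ≤ k →
  (∀ x → P x ≡ true → A (l x) ≡ true) → (∀ a → A a ≡ true → count (λ x → P x ∧ (l x ==ᶠ a)) ≤ t) → count P ≤ k * t
count-fibres k P A l t le PA fib with any? (λ a → A a ≟ᵇ true)
... | no none = ≤-trans (≤-reflexive (count-zero P λ x → not-false λ Px → none (l x , PA x Px))) z≤n
count-fibres zero P A l t le PA fib | yes (a , Aa) = contradiction (count>0 A Aa) (ℕₚ.≤⇒≯ le)
count-fibres (suc k) P A l t le PA fib | yes (a , Aa) = ≤-trans (≤-reflexive (count-split P (λ x → l x ==ᶠ a)))
  (ℕₚ.+-mono-≤ (fib a Aa) (count-fibres k (λ x → P x ∧ not (l x ==ᶠ a)) (A ∖ a) l t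
    (s≤s⁻¹ (≤-trans (≤-reflexive (count-∖ A a Aa)) le))
    (λ x q → let Px , ne = ∧-split {P x} q in ∖⁺ A (PA x Px) (==ᶠ⇒≢ (not-true ne)))
    (λ b Ab → ≤-trans (count-mono _ _ λ x q → let a , b = ∧-split {P x ∧ not _} q in ∧-join (proj₁ (∧-split {P x} a)) b)
                (fib b (proj₁ (∖⁻ A Ab))))))

module _ {t : ℕ} .{{_ : NonZero t}} where

  %-absorb : ∀ a b → (a % t + b) % t ≡ (a + b) % t
  %-absorb a b = trans (%-distribˡ-+ (a % t) b t) (trans (cong (λ z → (z + b % t) % t) (m%n%n≡m%n a t)) (sym (%-distribˡ-+ a b t)))

  shift-back : ∀ {s k} → s < t → k ≤ t → ((s + k) % t + (t ∸ k)) % t ≡ s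
  shift-back {s} {k} s<t k≤t = begin
    ((s + k) % t + (t ∸ k)) % t  ≡⟨ %-absorb (s + k) (t ∸ k) ⟩
    (s + k + (t ∸ k)) % t        ≡⟨ cong (_% t) (trans (ℕₚ.+-assoc s k (t ∸ k)) (cong (s +_) (ℕₚ.m+[n∸m]≡n k≤t))) ⟩
    (s + t) % t                  ≡⟨ [m+n]%n≡m%n s t ⟩
    s % t                        ≡⟨ m<n⇒m%n≡m s<t ⟩
    s                            ∎
    where open ≡-Reasoning

  -- The shifts by 0 to `t - 1` decompose the complete bipartite graph on two groups of `t` colours
  -- into perfect matchings, one for each parallel edge.
  shiftBy : ℕ → Fin t → Fin t
  shiftBy k s = fromℕ< (m%n<n (toℕ s + k % t) t)

  shiftBy-injective : ∀ k {s s'} → shiftBy k s ≡ shiftBy k s' → s ≡ s'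
  shiftBy-injective k {s} {s'} q = toℕ-injective (trans (sym (shift-back (toℕ<n s) k≤t))
    (trans (cong (λ z → (z + (t ∸ k % t)) % t) eq) (shift-back (toℕ<n s') k≤t)))
    where
    k≤t : k % t ≤ t
    k≤t = ℕₚ.<⇒≤ (m%n<n k t)
    eq : (toℕ s + k % t) % t ≡ (toℕ s' + k % t) % t
    eq = trans (sym (toℕ-fromℕ< _)) (trans (cong toℕ q) (toℕ-fromℕ< _))

  shiftBy-transitive : ∀ s s' → ∃ λ k → k < t × shiftBy k s ≡ s'
  shiftBy-transitive s s' = k , m%n<n _ t , toℕ-injective (begin
    toℕ (shiftBy k s)                          ≡⟨ toℕ-fromℕ< _ ⟩
    (toℕ s + k % t) % t                        ≡⟨ cong (_% t) (ℕₚ.+-comm (toℕ s) (k % t)) ⟩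
    (k % t + toℕ s) % t                        ≡⟨ %-absorb k (toℕ s) ⟩
    (k + toℕ s) % t                            ≡⟨ %-absorb (toℕ s' + (t ∸ toℕ s)) (toℕ s) ⟩
    (toℕ s' + (t ∸ toℕ s) + toℕ s) % t         ≡⟨ cong (_% t) (trans (ℕₚ.+-assoc (toℕ s') _ _) (cong (toℕ s' +_) (ℕₚ.m∸n+n≡m (ℕₚ.<⇒≤ (toℕ<n s))))) ⟩
    (toℕ s' + t) % t                           ≡⟨ [m+n]%n≡m%n (toℕ s') t ⟩
    toℕ s' % t                                 ≡⟨ m<n⇒m%n≡m (toℕ<n s') ⟩
    toℕ s'                                     ∎)
    where
    open ≡-Reasoning
    k : ℕ
    k = (toℕ s' + (t ∸ toℕ s)) % t

leastVertex : ∀ G e → ∃ λ v → inc G e v ≡ true × (∀ w → inc G e w ≡ true → toℕ v ≤ toℕ w)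
leastVertex G e = least (inc G e) (≤-trans (s≤s z≤n) (size G e))

-- Every vertex gets the colours Fin D, and the j-th edge of M e joins colour j at the least vertex of e
-- to colour θ e j at its other vertices.
module TwistedCover (G : Hypergraph) (D : ℕ) (θ : Fin (nE G) → Fin D → Fin D)
                    (θ-injective : ∀ e {i j} → θ e i ≡ θ e j → i ≡ j) where

  head : Fin (nE G) → Fin (nV G)
  head e = proj₁ (leastVertex G e)

  vertex : Fin (nV G * D) → Fin (nV G)
  vertex x = proj₁ (remQuot {nV G} D x)

  colour : Fin (nV G * D) → Fin D
  colour x = proj₂ (remQuot {nV G} D x)

  vertex-combine : ∀ v i → vertex (combine v i) ≡ v
  vertex-combine v i = cong proj₁ (remQuot-combine {nV G} {D} v i)

  colour-combine : ∀ v i → colour (combine v i) ≡ i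
  colour-combine v i = cong proj₂ (remQuot-combine {nV G} {D} v i)

  twist : Fin (nE G) → Fin D → Fin (nV G) → Fin D
  twist e j v = if v ==ᶠ head e then j else θ e j

  twist-injective : ∀ e {i j} v → twist e i v ≡ twist e j v → i ≡ j
  twist-injective e v q with v ==ᶠ head e
  ... | true = q
  ... | false = θ-injective e q

  matched : Fin (nE G) → Fin D → Fin (nV G * D) → Bool
  matched e j x = inc G e (vertex x) ∧ (colour x ==ᶠ twist e j (vertex x))

  determined : ∀ {x v i} → vertex x ≡ v → colour x ≡ i → x ≡ combine v i
  determined {x} refl refl = sym (combine-remQuot {nV G} D x)

  cover : Cover G
  cover = record
    { N = nV G * D
    ; p = vertex
    ; r = λ _ → D
    ; M = matched
    ; M-sub = λ e j x q → proj₁ (∧-split q)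
    ; M-meets = λ e j v v∈e → count-≡1 _ (combine v (twist e j v))
        (∧-join (∧-join (trans (cong (inc G e) (vertex-combine v _)) v∈e)
                  (==ᶠ⇐≡ (trans (colour-combine v _) (cong (twist e j) (sym (vertex-combine v _))))))
                (==ᶠ⇐≡ (vertex-combine v _)))
        (λ x q → let a , b = ∧-split {matched e j x} q
                     pv = ==ᶠ⇒≡ b
                 in determined pv (trans (==ᶠ⇒≡ (proj₂ (∧-split {inc G e (vertex x)} a))) (cong (twist e j) pv)))
    ; M-matching = λ e j j' x q q' → twist-injective e (vertex x)
        (trans (sym (==ᶠ⇒≡ (proj₂ (∧-split {inc G e (vertex x)} q)))) (==ᶠ⇒≡ (proj₂ (∧-split {inc G e (vertex x)} q')))) }

  D≤fiberSize : ∀ v → D ≤ fiberSize cover v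
  D≤fiberSize v = subst (_≤ fiberSize cover v) (count-all D) (count-inj {D} (λ _ → true) _ (λ i x → x ≡ combine v i)
    (λ i _ → combine v i , ==ᶠ⇐≡ (vertex-combine v i) , refl)
    (λ i i' x _ _ q q' → proj₂ (combine-injective v i v i' (trans (sym q) q'))))

  untwisted : Colorable cover → ∃ λ (f : Fin (nV G) → Fin D) →
    ∀ e → ¬ (∀ v → inc G e v ≡ true → v ≢ head e → f v ≡ θ e (f (head e)))
  untwisted (T , transversal , independent) = f , λ e h → independent e (f (head e)) λ x q →
    let v∈e , cq = ∧-split {inc G e (vertex x)} q
    in trans (cong T (determined {x} refl (trans (==ᶠ⇒≡ cq) (sym (twisted e h (vertex x) v∈e))))) (f-in (vertex x))
    where
    pick : ∀ v → ∃ λ x → T x ∧ (vertex x ==ᶠ v) ≡ true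
    pick v = count-pos _ (≤-reflexive (sym (transversal v)))
    f : Fin (nV G) → Fin D
    f v = colour (proj₁ (pick v))
    f-in : ∀ v → T (combine v (f v)) ≡ true
    f-in v with pick v
    ... | x , q = let Tx , b = ∧-split {T x} q in trans (cong T (sym (determined (==ᶠ⇒≡ b) refl))) Tx
    twisted : ∀ e → (∀ v → inc G e v ≡ true → v ≢ head e → f v ≡ θ e (f (head e))) →
      ∀ v → inc G e v ≡ true → f v ≡ twist e (f (head e)) v
    twisted e h v v∈e with v ≟ head e
    ... | yes refl = refl
    ... | no ne = h v v∈e ne

-- `DPColorable` bounds fibres only from below, so one uncolourable cover with at least `Δ G`
-- colours everywhere refutes all `j` at once.
not-colorable : ∀ G D → Δ G ≤ D → (C : Cover G) → (∀ v → D ≤ fiberSize C v) → ¬ Colorable C →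
  ∀ j → j < suc (Δ G) → ¬ DPColorable G j
not-colorable G D Δ≤D C big unc j j<sΔ col = unc (col C λ v → ≤-trans (s≤s⁻¹ j<sΔ) (≤-trans Δ≤D (big v)))

single-edge-uncolorable : ∀ G → IsSingleEdge G → ∀ j → j < suc (Δ G) → ¬ DPColorable G j
single-edge-uncolorable G (nE≡1 , _) = not-colorable G 1
  (maxOver-least (degree G) 1 λ v → ≤-trans (count-mono (λ e → inc G e v) (λ _ → true) (λ _ _ → refl)) (≤-reflexive (trans (count-all (nE G)) nE≡1)))
  cover D≤fiberSize λ col → let f , bad = untwisted col in bad (subst Fin (sym nE≡1) fzero) λ v _ _ → Fin1 (f v) _
  where
  open TwistedCover G 1 (λ _ i → i) (λ _ q → q)
  Fin1 : ∀ (a b : Fin 1) → a ≡ b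
  Fin1 fzero fzero = refl

-- The blow-up by t parallel edges of a cover of the underlying simple graph with m colours: for u < v, colour g at u
-- is matched to colour π u v g at v, and the t edges between them yield a complete bipartite graph.
module BlowUp (G : Hypergraph) (ord : Ordinary G) (t : ℕ) .{{_ : NonZero t}} (m : ℕ)
              (π : Fin (nV G) → Fin (nV G) → Fin m → Fin m) (π-injective : ∀ u v {i j} → π u v i ≡ π u v j → i ≡ j) where

  private
    V : Set
    V = Fin (nV G)

  lo hi : Fin (nE G) → V
  lo e = proj₁ (leastVertex G e)
  hi e = proj₁ (other G e (lo e))

  θ : Fin (nE G) → Fin (m * t) → Fin (m * t)
  θ e x = let g , s = remQuot {m} t x in
    combine (π (lo e) (hi e) g) (shiftBy (rank (λ f → inc G f (lo e) ∧ inc G f (hi e)) e) s)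

  θ-injective : ∀ e {x y} → θ e x ≡ θ e y → x ≡ y
  θ-injective e {x} {y} q with combine-injective {m} {t} _ _ _ _ q
  ... | a , b = trans (sym (combine-remQuot {m} t x)) (trans
    (cong₂ combine (π-injective _ _ a) (shiftBy-injective (rank (λ f → inc G f (lo e) ∧ inc G f (hi e)) e) b)) (combine-remQuot {m} t y))

  open TwistedCover G (m * t) θ θ-injective public using (cover; D≤fiberSize; untwisted)

  ends : ∀ {e u v} → toℕ u < toℕ v → inc G e u ≡ true → inc G e v ≡ true → lo e ≡ u × hi e ≡ v
  ends {e} {u} {v} u<v u∈e v∈e with leastVertex G e
  ... | w , w∈e , mn with count-2-exhaust (inc G e) (ord e) u∈e v∈e (λ { refl → ℕₚ.<-irrefl refl u<v }) w∈e
  ...   | inj₂ refl = contradiction u<v (ℕₚ.≤⇒≯ (mn u u∈e))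
  ...   | inj₁ refl with other G e u
  ...     | x , x∈e , x≢u with count-2-exhaust (inc G e) (ord e) u∈e v∈e (λ { refl → ℕₚ.<-irrefl refl u<v }) x∈e
  ...       | inj₁ q = contradiction q x≢u
  ...       | inj₂ q = refl , q

  -- If the groups chosen at `u` and `v` were matched by `π`, some shift would carry the position
  -- inside one group to that inside the other. With `t` edges between `u` and `v`, one of them has
  -- this shift, and it would be hit.
  reduced : Colorable cover → ∃ λ (g : V → Fin m) → ∀ u v → toℕ u < toℕ v → mult G u v ≡ t → g v ≢ π u v (g u)
  reduced col with untwisted col
  ... | f , bad = (λ v → proj₁ (remQuot {m} t (f v))) , conflict
    where
    conflict : ∀ u v → toℕ u < toℕ v → mult G u v ≡ t → proj₁ (remQuot {m} t (f v)) ≢ π u v (proj₁ (remQuot {m} t (f u)))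
    conflict u v u<v mt q with shiftBy-transitive (proj₂ (remQuot {m} t (f u))) (proj₂ (remQuot {m} t (f v)))
    ... | k , k<t , sq with rank-onto (λ e → inc G e u ∧ inc G e v) k (subst (k <_) (sym mt) k<t)
    ...   | e , euv , rk with ∧-split euv
    ...     | u∈e , v∈e with ends u<v u∈e v∈e
    ...       | lo≡ , hi≡ = bad e only
      where
      eq : f v ≡ θ e (f u)
      eq = begin
        f v ≡⟨ sym (combine-remQuot {m} t (f v)) ⟩
        combine (proj₁ (remQuot {m} t (f v))) (proj₂ (remQuot {m} t (f v)))
          ≡⟨ cong₂ combine q (trans (sym sq) (cong (λ k → shiftBy k _) (sym rk))) ⟩
        combine (π u v _) (shiftBy (rank (λ f → inc G f u ∧ inc G f v) e) _)
          ≡⟨ cong₂ (λ a b → combine (π a b _) (shiftBy (rank (λ f → inc G f a ∧ inc G f b) e) _)) (sym lo≡) (sym hi≡) ⟩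
        θ e (f u) ∎
        where open ≡-Reasoning
      only : ∀ w → inc G e w ≡ true → w ≢ lo e → f w ≡ θ e (f (lo e))
      only w w∈e w≢ with count-2-exhaust (inc G e) (ord e) u∈e v∈e (λ { refl → ℕₚ.<-irrefl refl u<v }) w∈e
      ... | inj₁ refl = contradiction (sym lo≡) w≢
      ... | inj₂ refl = trans eq (cong (λ z → θ e (f z)) (sym lo≡))

-- Edges at `u` are sorted by the label of one other end: at most `k` labels, at most `t` edges
-- each. Labelling through `σ` suits cycles, whose neighbourhoods are known by cyclic position.
degree-bound : ∀ G t k u (A : Fin (nV G) → Bool) (σ σ⁻¹ : Fin (nV G) → Fin (nV G)) → (∀ v → σ (σ⁻¹ v) ≡ v) →
  count A ≤ k → (∀ a → σ a ≢ u → 0 < mult G u (σ a) → A a ≡ true) → (∀ a → A a ≡ true → mult G u (σ a) ≤ t) →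
  degree G u ≤ k * t
degree-bound G t k u A σ σ⁻¹ inverse le adj⊆A bound = count-fibres k (λ e → inc G e u) A label t le
  (λ e u∈e → adj⊆A (label e) (subst (_≢ u) (sym (inverse (end e))) (end≢ e))
    (count>0 (λ f → inc G f u ∧ inc G f (σ (label e))) (∧-join u∈e (end∈ e))))
  (λ a Aa → ≤-trans (count-mono _ (λ e → inc G e u ∧ inc G e (σ a)) λ e q → let u∈e , la = ∧-split q in
    ∧-join u∈e (subst (λ b → inc G e (σ b) ≡ true) (==ᶠ⇒≡ la) (end∈ e))) (bound a Aa))
  where
  end : Fin (nE G) → Fin (nV G)
  end e = proj₁ (other G e u)
  end≢ : ∀ e → end e ≢ u
  end≢ e = proj₂ (proj₂ (other G e u))
  label : Fin (nE G) → Fin (nV G)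
  label e = σ⁻¹ (end e)
  end∈ : ∀ e → inc G e (σ (label e)) ≡ true
  end∈ e = trans (cong (inc G e) (inverse (end e))) (proj₁ (proj₂ (other G e u)))

-- There is one group of colours fewer than vertices, so two vertices choose from the same group.
tK-uncolorable : ∀ G → IsTK G → ∀ j → j < suc (Δ G) → ¬ DPColorable G j
tK-uncolorable G (suc t , _ , 0<n , ord , mults) with predecessor 0<n
... | k , sk≡n = not-colorable G (k * suc t) (maxOver-least (degree G) _ degrees) cover D≤fiberSize (λ col → overfull (reduced col))
  where
  open BlowUp G ord (suc t) k (λ _ _ g → g) (λ _ _ q → q)
  degrees : ∀ u → degree G u ≤ k * suc t
  degrees u = degree-bound G (suc t) k u ((λ _ → true) ∖ u) (λ v → v) (λ v → v) (λ _ → refl)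
    (≤-reflexive (ℕₚ.suc-injective (trans (count-∖ (λ _ → true) u refl) (trans (count-all (nV G)) (sym sk≡n)))))
    (λ a a≢u _ → ∖⁺ (λ _ → true) {z = a} refl a≢u)
    (λ a Aa → ≤-reflexive (mults u a λ q → proj₂ (∖⁻ (λ _ → true) {z = a} Aa) (sym q)))
  overfull : ¬ ∃ λ (g : Fin (nV G) → Fin k) → ∀ u v → toℕ u < toℕ v → mult G u v ≡ suc t → g v ≢ g u
  overfull (g , proper) with pigeonhole (≤-reflexive sk≡n) g
  ... | u , v , u<v , q = proper u v u<v (mults u v λ { refl → ℕₚ.<-irrefl refl u<v }) (sym q)

cycAdj? : ∀ {n} (a b : Fin n) → Dec (CycAdj a b)
cycAdj? {n} a b = (suc (toℕ a) ℕₚ.≟ toℕ b) ⊎-dec ((suc (toℕ b) ℕₚ.≟ toℕ a) ⊎-dec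
  (((toℕ a ℕₚ.≟ 0) ×-dec (suc (toℕ b) ℕₚ.≟ n)) ⊎-dec ((toℕ b ℕₚ.≟ 0) ×-dec (suc (toℕ a) ℕₚ.≟ n))))

cycAdj-count : ∀ {n} (a : Fin n) → count (λ b → does (cycAdj? a b)) ≤ 2
cycAdj-count {n} a = count-inj _ (λ (_ : Fin 2) → true) Side side unique
  where
  -- Label `fzero` marks the cyclic successor of `a`, the other label its predecessor.
  Side : Fin n → Fin 2 → Set
  Side b fzero = suc (toℕ a) ≡ toℕ b ⊎ (toℕ b ≡ 0 × suc (toℕ a) ≡ n)
  Side b (fsuc _) = suc (toℕ b) ≡ toℕ a ⊎ (toℕ a ≡ 0 × suc (toℕ b) ≡ n)
  side : ∀ b → does (cycAdj? a b) ≡ true → ∃ λ i → true ≡ true × Side b i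
  side b q with does-sound (cycAdj? a b) q
  ... | inj₁ r = fzero , refl , inj₁ r
  ... | inj₂ (inj₁ r) = fsuc fzero , refl , inj₁ r
  ... | inj₂ (inj₂ (inj₁ r)) = fsuc fzero , refl , inj₂ r
  ... | inj₂ (inj₂ (inj₂ r)) = fzero , refl , inj₂ r
  beyond : ∀ (b : Fin n) {x} → suc x ≡ toℕ b → suc x ≡ n → ⊥
  beyond b p q = ℕₚ.<-irrefl (trans (sym p) q) (toℕ<n b)
  unique : ∀ b b' i → _ → _ → Side b i → Side b' i → b ≡ b'
  unique b b' fzero _ _ (inj₁ p) (inj₁ q) = toℕ-injective (trans (sym p) q)
  unique b b' fzero _ _ (inj₁ p) (inj₂ (_ , q)) = ⊥-elim (beyond b p q)
  unique b b' fzero _ _ (inj₂ (_ , q)) (inj₁ p) = ⊥-elim (beyond b' p q)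
  unique b b' fzero _ _ (inj₂ (p , _)) (inj₂ (q , _)) = toℕ-injective (trans p (sym q))
  unique b b' (fsuc fzero) _ _ (inj₁ p) (inj₁ q) = toℕ-injective (ℕₚ.suc-injective (trans p (sym q)))
  unique b b' (fsuc fzero) _ _ (inj₁ p) (inj₂ (q , _)) = contradiction (trans p q) λ ()
  unique b b' (fsuc fzero) _ _ (inj₂ (q , _)) (inj₁ p) = contradiction (trans p q) λ ()
  unique b b' (fsuc fzero) _ _ (inj₂ (_ , p)) (inj₂ (_ , q)) = toℕ-injective (ℕₚ.suc-injective (trans p (sym q)))

injective⇒onto : (σ : Fin n → Fin n) → Injective _≡_ _≡_ σ → ∀ v → ∃ λ a → σ a ≡ v
injective⇒onto {n} σ inj v with any? (λ a → σ a ≟ v)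
... | yes r = r
... | no none = contradiction (≤-reflexive (count-∖ (λ _ → true) v refl))
  (ℕₚ.≤⇒≯ (count-inj (λ _ → true) ((λ _ → true) ∖ v) (λ a w → σ a ≡ w)
    (λ a _ → σ a , ∖⁺ (λ _ → true) {z = σ a} refl (λ q → none (a , q)) , refl)
    (λ a b w _ _ p q → inj (trans p (sym q)))))

swap : Fin 2 → Fin 2
swap fzero = fsuc fzero
swap (fsuc _) = fzero

swap-injective : ∀ {i j} → swap i ≡ swap j → i ≡ j
swap-injective {fzero} {fzero} _ = refl
swap-injective {fsuc fzero} {fsuc fzero} _ = refl

≢swap : ∀ {i j} → i ≢ swap j → i ≡ j
≢swap {fzero} {fzero} _ = refl
≢swap {fzero} {fsuc fzero} ne = contradiction refl ne
≢swap {fsuc fzero} {fzero} ne = contradiction refl ne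
≢swap {fsuc fzero} {fsuc fzero} _ = refl

-- With two colours up to blow-up, each edge of the cycle forces equal colours at its ends, except for the
-- closing edge between σ 0 and σ (n − 1), which forces different ones.
tC-uncolorable : ∀ G → IsTC G → ∀ j → j < suc (Δ G) → ¬ DPColorable G j
tC-uncolorable G (suc t , _ , 3≤n , ord , σ , σ-inj , mults) = not-colorable G (2 * suc t) (maxOver-least (degree G) _ degrees) cover D≤fiberSize
  (λ col → inconsistent (reduced col))
  where
  V : Set
  V = Fin (nV G)
  0<n : 0 < nV G
  0<n = ≤-trans (s≤s z≤n) 3≤n
  l : ℕ
  l = proj₁ (predecessor 0<n)
  sl≡n : suc l ≡ nV G
  sl≡n = proj₂ (predecessor 0<n)
  first last : V
  first = fromℕ< 0<n
  last = fromℕ< (≤-reflexive sl≡n)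
  toℕ-first : toℕ first ≡ 0
  toℕ-first = toℕ-fromℕ< 0<n
  toℕ-last : toℕ last ≡ l
  toℕ-last = toℕ-fromℕ< (≤-reflexive sl≡n)
  2≤l : 2 ≤ l
  2≤l = s≤s⁻¹ (subst (3 ≤_) (sym sl≡n) 3≤n)
  Closing : V → V → Set
  Closing u v = (u ≡ σ first × v ≡ σ last) ⊎ (u ≡ σ last × v ≡ σ first)
  closing? : ∀ u v → Dec (Closing u v)
  closing? u v = ((u ≟ σ first) ×-dec (v ≟ σ last)) ⊎-dec ((u ≟ σ last) ×-dec (v ≟ σ first))
  -- `π` names the forbidden partner: the identity forbids equal colours, `swap` different ones.
  π : V → V → Fin 2 → Fin 2
  π u v with closing? u v
  ... | yes _ = λ g → g
  ... | no _ = swap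
  π-injective : ∀ u v {i j} → π u v i ≡ π u v j → i ≡ j
  π-injective u v q with closing? u v
  ... | yes _ = q
  ... | no _ = swap-injective q
  open BlowUp G ord (suc t) 2 π π-injective
  degrees : ∀ u → degree G u ≤ 2 * suc t
  degrees u with injective⇒onto σ σ-inj u
  ... | a , refl = degree-bound G (suc t) 2 (σ a) (λ b → does (cycAdj? a b)) σ (λ v → proj₁ (injective⇒onto σ σ-inj v))
    (λ v → proj₂ (injective⇒onto σ σ-inj v)) (cycAdj-count a)
    (λ b σb≢ pos → dec-true (cycAdj? a b) (decidable-stable (cycAdj? a b) λ nadj →
      ℕₚ.<-irrefl (sym (proj₂ (mults a b (λ { refl → σb≢ refl })) nadj)) pos))
    bound
    where
    bound : ∀ b → does (cycAdj? a b) ≡ true → mult G (σ a) (σ b) ≤ suc t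
    bound b q with a ≟ b
    ... | no a≢b = ≤-reflexive (proj₁ (mults a b a≢b) (does-sound (cycAdj? a b) q))
    ... | yes refl = ⊥-elim (loop (does-sound (cycAdj? a a) q))
      where
      loop : CycAdj a a → ⊥
      loop (inj₁ r) = ℕₚ.<⇒≢ ≤-refl (sym r)
      loop (inj₂ (inj₁ r)) = ℕₚ.<⇒≢ ≤-refl (sym r)
      loop (inj₂ (inj₂ (inj₁ (r , r')))) = contradiction (subst (3 ≤_) (trans (sym r') (cong suc r)) 3≤n) λ { (s≤s ()) }
      loop (inj₂ (inj₂ (inj₂ (r , r')))) = contradiction (subst (3 ≤_) (trans (sym r') (cong suc r)) 3≤n) λ { (s≤s ()) }
  inconsistent : ¬ ∃ λ (g : V → Fin 2) → ∀ u v → toℕ u < toℕ v → mult G u v ≡ suc t → g v ≢ π u v (g u)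
  inconsistent (g , proper) = differ first last first≢last (inj₂ (inj₂ (inj₁ (toℕ-first , trans (cong suc toℕ-last) sl≡n)))) (inj₁ (refl , refl))
        (trans (constant 0 first toℕ-first) (sym (constant l last toℕ-last)))
    where
    first≢last : first ≢ last
    first≢last q = contradiction (subst (2 ≤_) (trans (sym toℕ-last) (trans (cong toℕ (sym q)) toℕ-first)) 2≤l) λ ()
    σ-≢ : ∀ {a b} → a ≢ b → σ a ≢ σ b
    σ-≢ a≢b q = a≢b (σ-inj q)
    closing-sym : ∀ {u v} → Closing u v → Closing v u
    closing-sym (inj₁ (p , q)) = inj₂ (q , p)
    closing-sym (inj₂ (p , q)) = inj₁ (q , p)
    cyc-sym : ∀ {a b : V} → CycAdj a b → CycAdj b a
    cyc-sym (inj₁ p) = inj₂ (inj₁ p)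
    cyc-sym (inj₂ (inj₁ p)) = inj₁ p
    cyc-sym (inj₂ (inj₂ (inj₁ p))) = inj₂ (inj₂ (inj₂ p))
    cyc-sym (inj₂ (inj₂ (inj₂ p))) = inj₂ (inj₂ (inj₁ p))
    π-closing : ∀ {u v} → Closing u v → ∀ i → π u v i ≡ i
    π-closing {u} {v} cl i with closing? u v
    ... | yes _ = refl
    ... | no ncl = contradiction cl ncl
    π-open : ∀ {u v} → ¬ Closing u v → ∀ i → π u v i ≡ swap i
    π-open {u} {v} ncl i with closing? u v
    ... | yes cl = contradiction cl ncl
    ... | no _ = refl
    differ : ∀ a b → a ≢ b → CycAdj a b → Closing (σ a) (σ b) → g (σ a) ≢ g (σ b)
    differ a b a≢b cyc cl q with ℕₚ.<-cmp (toℕ (σ a)) (toℕ (σ b))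
    ... | tri≈ _ r _ = σ-≢ a≢b (toℕ-injective r)
    ... | tri< lt _ _ = proper (σ a) (σ b) lt (proj₁ (mults a b a≢b) cyc) (trans (sym q) (sym (π-closing cl _)))
    ... | tri> _ _ gt = proper (σ b) (σ a) gt (proj₁ (mults b a (λ r → a≢b (sym r))) (cyc-sym cyc)) (trans q (sym (π-closing (closing-sym cl) _)))
    agree : ∀ a b → a ≢ b → CycAdj a b → ¬ Closing (σ a) (σ b) → g (σ a) ≡ g (σ b)
    agree a b a≢b cyc ncl with ℕₚ.<-cmp (toℕ (σ a)) (toℕ (σ b))
    ... | tri≈ _ r _ = contradiction (toℕ-injective r) (σ-≢ a≢b)
    ... | tri< lt _ _ = sym (≢swap λ q → proper (σ a) (σ b) lt (proj₁ (mults a b a≢b) cyc) (trans q (sym (π-open ncl _))))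
    ... | tri> _ _ gt = ≢swap λ q → proper (σ b) (σ a) gt (proj₁ (mults b a (λ r → a≢b (sym r))) (cyc-sym cyc))
            (trans q (sym (π-open (λ cl → ncl (closing-sym cl)) _)))
    constant : ∀ i a → toℕ a ≡ i → g (σ a) ≡ g (σ first)
    constant zero a q = cong (λ b → g (σ b)) (toℕ-injective (trans q (sym toℕ-first)))
    constant (suc i) a q = trans (agree a b a≢b (inj₂ (inj₁ sb≡a)) not-closing) (constant i b toℕ-b)
      where
      i<n : i < nV G
      i<n = ≤-trans (ℕₚ.n≤1+n _) (subst (_< nV G) q (toℕ<n a))
      b : V
      b = fromℕ< i<n
      toℕ-b : toℕ b ≡ i
      toℕ-b = toℕ-fromℕ< i<n
      sb≡a : suc (toℕ b) ≡ toℕ a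
      sb≡a = trans (cong suc toℕ-b) (sym q)
      a≢b : a ≢ b
      a≢b r = ℕₚ.<⇒≢ ≤-refl (trans (cong toℕ (sym r)) (sym sb≡a))
      not-closing : ¬ Closing (σ a) (σ b)
      not-closing (inj₁ (r , _)) = contradiction (trans (sym q) (trans (cong toℕ (σ-inj r)) toℕ-first)) λ ()
      -- Here the last position would directly follow the first, which leaves only two vertices.
      not-closing (inj₂ (r , s)) = contradiction (subst (2 ≤_) l≡1 2≤l) λ { (s≤s ()) }
        where
        l≡1 : l ≡ 1
        l≡1 = trans (sym toℕ-last) (trans (cong toℕ (sym (σ-inj r))) (trans (sym sb≡a) (cong suc (trans (cong toℕ (σ-inj s)) toℕ-first))))

brick-uncolorable : ∀ G → DPHyperbrick G → ∀ j → j < suc (Δ G) → ¬ DPColorable G j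
brick-uncolorable G (inj₁ tk) = tK-uncolorable G tk
brick-uncolorable G (inj₂ (inj₁ tc)) = tC-uncolorable G tc
brick-uncolorable G (inj₂ (inj₂ se)) = single-edge-uncolorable G se

-- Small orders and the theorem

adjacent-pair : ∀ {G} → Connected G → {u v : Fin (nV G)} → u ≢ v → ∃ λ x → Adj G x v × x ≢ v
adjacent-pair {G} conn {u} {v} u≢v with crossing G ⁅ v ⁆ (connAv-∅ {G} conn v u refl) (==ᶠ⇐≢ u≢v) (==ᶠ⇐≡ {a = v} refl)
... | x , y , _ , x∉ , y∈ , xy = x , subst (Adj G x) (==ᶠ⇒≡ y∈) xy , ==ᶠ⇒≢ x∉

uncolorable⇒brick : ∀ G → Connected G → ¬ DPColorable G (Δ G) → DPHyperbrick G
uncolorable⇒brick G conn ¬col = by-order (nV G) refl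
  where
  by-order : ∀ n → nV G ≡ n → DPHyperbrick G
  -- The empty hypergraph has `Δ G` equal to 0 and is colourable with 0 colours, so it does not
  -- arise.
  by-order 0 q = contradiction (λ C _ → colorable-by-degree C λ v → ⊥-elim (no-vertex (subst Fin q v))) ¬col
    where
    no-vertex : ¬ Fin 0
    no-vertex ()
  -- A single vertex carries no edge; no pair constrains the multiplicity, which is set to 1.
  by-order 1 q = inj₁ (1 , ≤-refl , ≤-reflexive (sym q) , (λ e → ⊥-elim (small e)) , λ u v u≢v → contradiction (subsingleton u v) u≢v)
    where
    subsingleton : ∀ (u v : Fin (nV G)) → u ≡ v
    subsingleton u v = toℕ-injective (trans (ℕₚ.n<1⇒n≡0 (subst (toℕ u <_) q (toℕ<n u))) (sym (ℕₚ.n<1⇒n≡0 (subst (toℕ v <_) q (toℕ<n v)))))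
    small : ¬ Fin (nE G)
    small e with count-pos (inc G e) (≤-trans (s≤s z≤n) (size G e))
    ... | v , _ with other G e v
    ...   | u , _ , u≢v = u≢v (subsingleton u v)
  by-order 2 q = inj₁ (mult G a b , adj⇒mult>0 {G} (pair-adj) , ≤-trans (s≤s z≤n) (≤-reflexive (sym q)) ,
      (λ e → ≤-antisym (≤-trans (count-mono (inc G e) (λ _ → true) λ _ _ → refl) (≤-reflexive (trans (count-all (nV G)) q))) (size G e)) , same)
    where
    a b : Fin (nV G)
    a = fromℕ< (subst (0 <_) (sym q) (s≤s z≤n))
    b = fromℕ< (subst (1 <_) (sym q) ≤-refl)
    toℕ-a : toℕ a ≡ 0
    toℕ-a = toℕ-fromℕ< _
    toℕ-b : toℕ b ≡ 1
    toℕ-b = toℕ-fromℕ< _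
    a≢b : a ≢ b
    a≢b r = contradiction (trans (sym toℕ-a) (trans (cong toℕ r) toℕ-b)) λ ()
    which : ∀ v → v ≡ a ⊎ v ≡ b
    which v with toℕ v in tv | subst (toℕ v <_) q (toℕ<n v)
    ... | 0 | _ = inj₁ (toℕ-injective (trans tv (sym toℕ-a)))
    ... | 1 | _ = inj₂ (toℕ-injective (trans tv (sym toℕ-b)))
    ... | suc (suc _) | s≤s (s≤s ())
    pair-adj : Adj G a b
    pair-adj with adjacent-pair {G} conn a≢b
    ... | x , xb , x≢b with which x
    ...   | inj₁ refl = xb
    ...   | inj₂ refl = contradiction refl x≢b
    same : ∀ u v → u ≢ v → mult G u v ≡ mult G a b
    same u v u≢v with which u | which v
    ... | inj₁ refl | inj₁ refl = contradiction refl u≢v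
    ... | inj₁ refl | inj₂ refl = refl
    ... | inj₂ refl | inj₁ refl = mult-sym {G} b a
    ... | inj₂ refl | inj₂ refl = contradiction refl u≢v
  by-order (suc (suc (suc n))) q = Classification.brick G conn 0<Δ ¬col (Structure.hamiltonian G conn 0<Δ ¬col v₀) 3≤n
    where
    3≤n : 3 ≤ nV G
    3≤n = subst (3 ≤_) (sym q) (s≤s (s≤s (s≤s z≤n)))
    v₀ v₁ : Fin (nV G)
    v₀ = fromℕ< (≤-trans (s≤s z≤n) 3≤n)
    v₁ = fromℕ< (≤-trans (s≤s (s≤s z≤n)) 3≤n)
    v₀≢v₁ : v₀ ≢ v₁
    v₀≢v₁ r = contradiction (trans (sym (toℕ-fromℕ< _)) (trans (cong toℕ r) (toℕ-fromℕ< (≤-trans (s≤s (s≤s z≤n)) 3≤n)))) λ ()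
    0<Δ : 0 < Δ G
    0<Δ with adjacent-pair {G} conn v₀≢v₁
    ... | x , (e , _ , v∈e) , _ = ≤-trans (count>0 (λ e → inc G e v₁) v∈e) (degree≤Δ G v₁)

theorem10 : (G : Hypergraph) → Connected G →
    DPColorable G (suc (Δ G)) × (IsDPChromaticNumber G (suc (Δ G)) ⇔ DPHyperbrick G)
theorem10 G conn = DPColorable-suc-Δ G , mk⇔
  (λ (_ , ¬fewer) → uncolorable⇒brick G conn (¬fewer (Δ G) ≤-refl))
  (λ brick → DPColorable-suc-Δ G , brick-uncolorable G brick)
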